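{- For $n\ge3$ with $n\not\equiv 2\pmod 4$, $p_n(\Sigma^-_2)=C'(n,2)=L_2(n)$, where $L_2(n)=\frac1n\sum_{d\mid n}\mu(d)2^{n/d}$ and $\mu$ is the Möbius function.
   Context: For $\sigma\in\{+,-\}^k$ ($k\ge2$), let $\mathcal W_k$ be the set of infinite words over $\{0,\dots,k-1\}$ with the linear order $\prec_\sigma$: for $s\neq t$, with $j$ the first index where $s_j\neq t_j$ and $c=|\{i<j:\sigma_{s_i}=-\}|$, $s\prec_\sigma t$ iff ($c$ even and $s_j<t_j$) or ($c$ odd and $s_j>t_j$). The signed shift $\Sigma_\sigma$ deletes the first letter of a word. Let $\mathcal W_{k,n}$ be the set of words $(s_1\dots s_n)^\infty$ with $s_1\dots s_n$ primitive (not a power of a shorter word). For $s\in\mathcal W_{k,n}$ let $\Pi_\sigma(s)\in\mathcal S_n$ be the permutation with $\Pi_\sigma(s)_i<\Pi_\sigma(s)_j$ iff $s_is_{i+1}\dots\prec_\sigma s_js_{j+1}\dots$. Let $\mathcal P_n(\Sigma_\sigma)=\{\Pi_\sigma(s):s\in\mathcal W_{k,n}\}$ and $p_n(\Sigma_\sigma)=|\mathcal P_n(\Sigma_\sigma)|/n$ (the number of classes of $\mathcal P_n(\Sigma_\sigma)$ under cyclic rotation). $\Sigma^-_k$ denotes the reverse $k$-shift $\Sigma_{ -^k}$ (all signs $-$). $C'(n,i)$ denotes the number of cyclic permutations ($n$-cycles) in $\mathcal S_n$ with exactly $i-1$ ascents, an ascent of $\tau$ being an $i\in[n-1]$ with $\tau_i<\tau_{i+1}$.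 -}

module Defs where

open import Data.Nat using (ℕ; zero; suc; _+_; _*_; _∸_; _^_; _≤_; _<_; _≤ᵇ_; _<ᵇ_; NonZero)
open import Data.Nat.DivMod using (_/_; _%_; _mod_)
open import Data.Nat.Divisibility using (_∣_; _∣?_)
open import Data.Integer as ℤ using (ℤ; +_; -_; 0ℤ; 1ℤ)
open import Data.Fin using (Fin; toℕ)
open import Data.Vec using (Vec; lookup; toList; map)
open import Data.List as List using (List; []; _∷_; length; upTo)
open import Data.List.Membership.Propositional using (_∈_)
open import Data.List.Relation.Unary.Unique.Propositional using (Unique)
open import Data.Bool using (Bool; true; false; if_then_else_)
open import Data.Product using (Σ; ∃; _×_; _,_)
open import Data.Sum using (_⊎_)
open import Function using (_∘_; _⇔_)
open import Function.Base using (id)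
open import Relation.Nullary using (¬_)
open import Relation.Nullary.Decidable using (⌊_⌋)
open import Relation.Binary.PropositionalEquality using (_≡_)

HasSize : {A : Set} → (A → Set) → ℕ → Set
HasSize {A} P m =
  Σ (List A) λ xs → Unique xs × (∀ x → (x ∈ xs) ⇔ P x) × length xs ≡ m

data Sign : Set where
  plus minus : Sign

isMinus : Sign → Bool
isMinus plus  = false
isMinus minus = true

InfWord : ℕ → Set
InfWord k = ℕ → Fin k

negCount : {k : ℕ} → (Fin k → Sign) → InfWord k → ℕ → ℕ
negCount σ s zero    = 0
negCount σ s (suc j) = negCount σ s j + (if isMinus (σ (s j)) then 1 else 0)

Prec : {k : ℕ} → (Fin k → Sign) → InfWord k → InfWord k → Set
Prec σ s t = ∃ λ j → (∀ i → i < j → s i ≡ t i) ×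
  ( (negCount σ s j % 2 ≡ 0 × toℕ (s j) < toℕ (t j))
  ⊎ (negCount σ s j % 2 ≡ 1 × toℕ (t j) < toℕ (s j)) )

shiftBy : {k : ℕ} → ℕ → InfWord k → InfWord k
shiftBy i s m = s (i + m)

periodic : {k n : ℕ} .{{_ : NonZero n}} → Vec (Fin k) n → InfWord k
periodic {n = n} w m = lookup w (m mod n)

IsPowerOfPrefix : {k n : ℕ} → Vec (Fin k) n → (d : ℕ) → .{{_ : NonZero d}} → Set
IsPowerOfPrefix {n = n} w d =
  d ∣ n × (∀ (i : Fin n) → (i% : Fin n) → toℕ i% ≡ toℕ i % d → lookup w i ≡ lookup w i%)

Primitive : {k n : ℕ} → Vec (Fin k) n → Set
Primitive {n = n} w = ∀ d → suc d < n → ¬ IsPowerOfPrefix w (suc d)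

IsPerm : {n : ℕ} → Vec (Fin n) n → Set
IsPerm {n} π = ∀ i j → lookup π i ≡ lookup π j → i ≡ j

IsPatternOf : {k n : ℕ} .{{_ : NonZero n}} → (Fin k → Sign) →
              Vec (Fin k) n → Vec (Fin n) n → Set
IsPatternOf {n = n} σ w π = IsPerm π ×
  (∀ (i j : Fin n) → (toℕ (lookup π i) < toℕ (lookup π j))
     ⇔ Prec σ (shiftBy (toℕ i) (periodic w)) (shiftBy (toℕ j) (periodic w)))

InPatterns : {k : ℕ} → (Fin k → Sign) → (n : ℕ) → .{{_ : NonZero n}} →
             Vec (Fin n) n → Set
InPatterns {k} σ n π = ∃ λ (w : Vec (Fin k) n) → Primitive w × IsPatternOf σ w π

allMinus : {k : ℕ} → Fin k → Sign
allMinus _ = minus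

iter : {A : Set} → (A → A) → ℕ → A → A
iter f zero    = id
iter f (suc m) = f ∘ iter f m

IsCyclic : {n : ℕ} → Vec (Fin n) n → Set
IsCyclic {n} π = IsPerm π × (∀ i j → ∃ λ m → iter (lookup π) m i ≡ j)

ascList : List ℕ → ℕ
ascList []            = 0
ascList (x ∷ [])      = 0
ascList (x ∷ y ∷ r)   = (if x <ᵇ y then 1 else 0) + ascList (y ∷ r)

ascents : {n : ℕ} → Vec (Fin n) n → ℕ
ascents π = ascList (toList (map toℕ π))

InC' : (n i : ℕ) → Vec (Fin n) n → Set
InC' n i τ = IsCyclic τ × ascents τ ≡ i ∸ 1

-- smallest divisor ≥ 2 + r of n, returned as its offset from 2
spfFrom : ℕ → ℕ → ℕ → ℕ
spfFrom zero       n r = r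
spfFrom (suc fuel) n r =
  if ⌊ (2 + r) ∣? n ⌋ then r else spfFrom fuel n (suc r)

μ-fuel : ℕ → ℕ → ℤ
μ-fuel zero       n = 1ℤ
μ-fuel (suc fuel) n with n ≤ᵇ 1
... | true  = 1ℤ
... | false with spfFrom n n 0
...   | r = if ⌊ ((2 + r) * (2 + r)) ∣? n ⌋
              then 0ℤ
              else - μ-fuel fuel (n / (2 + r))

μ : ℕ → ℤ
μ n = μ-fuel n n

nL₂ : ℕ → ℤ
nL₂ n = List.foldr ℤ._+_ 0ℤ
  (List.map (λ i → if ⌊ suc i ∣? n ⌋ then μ (suc i) ℤ.* (+ (2 ^ (n / suc i))) else 0ℤ)
            (upTo n))

{-# OPTIONS --safe #-}
module Submission where

open import Defs
open import Algebra.Properties.CommutativeSemigroup using (x∙yz≈y∙xz)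
open import Data.Bool using (true; false; T; if_then_else_)
open import Data.Fin as Fin using (Fin; zero; suc; toℕ; fromℕ<; punchOut)
import Data.Fin.Properties as Fin
open import Data.Integer as ℤ using (ℤ; +_; -_; 0ℤ; 1ℤ)
import Data.Integer.Properties as ℤ
open import Data.List as List using (List; []; _∷_; length)
import Data.List.Properties as List
open import Data.List.Membership.Propositional using (_∈_; lose)
open import Data.List.Membership.Propositional.Properties using (∈-map⁺; ∈-map⁻; ∈-upTo⁺; ∈-filter⁺; ∈-filter⁻; ∈-deduplicate⁺; ∈-deduplicate⁻; ∈-cartesianProductWith⁺; ∈-cartesianProductWith⁻; ∈-allFin)
open import Data.List.Membership.Propositional.Properties.WithK using (unique∧set⇒bag)
open import Data.List.Relation.Binary.BagAndSetEquality using (∼bag⇒↭)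
open import Data.List.Relation.Binary.Permutation.Propositional using (_↭_; ↭⇒↭ₛ)
open import Data.List.Relation.Binary.Permutation.Propositional.Properties using (↭-length) renaming (map⁺ to ↭-map⁺)
open import Data.List.Relation.Binary.Permutation.Setoid.Properties ℤ.≡-setoid using (foldr-commMonoid)
open import Data.List.Relation.Binary.Pointwise as Pointwise using (Pointwise; []; _∷_)
open import Data.List.Relation.Unary.All as All using ([])
open import Data.List.Relation.Unary.AllPairs using ([]; _∷_)
open import Data.List.Relation.Unary.Any using (here; there)
open import Data.List.Relation.Unary.Unique.Propositional using (Unique)
import Data.List.Relation.Unary.Unique.DecPropositional.Properties as DecUnique
import Data.List.Relation.Unary.Unique.Propositional.Properties as Unique
open import Data.Nat using (ℕ; zero; suc; pred; _+_; _*_; _∸_; _^_; _/_; _%_; _≤_; _<_; z≤n; s≤s; _<ᵇ_; _≟_; NonZero; ≢-nonZero; ≢-nonZero⁻¹; >-nonZero; >-nonZero⁻¹)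
open import Data.Nat.Divisibility
open import Data.Nat.DivMod
open import Data.Nat.GCD using (gcd; gcd[m,n]∣m; gcd[m,n]∣n; gcd-GCD; module Bézout)
open import Data.Nat.Induction using (<-rec)
open import Data.Nat.Primality using (Prime; _Rough_; 2-rough; rough⇒≤; ∤⇒rough-suc; rough∧∣⇒rough; rough∧∣⇒prime; euclidsLemma)
open import Data.Nat.Properties
open import Data.Nat.Tactic.RingSolver using (solve-∀)
open import Data.Product using (Σ; ∃; _×_; _,_; proj₁; proj₂)
open import Data.Product.Properties using (,-injective)
open import Data.Sum as Sum using (_⊎_; inj₁; inj₂)
open import Data.Unit using (⊤; tt)
open import Data.Vec as Vec using (Vec; []; _∷_; lookup; tabulate; toList)
open import Data.Vec.Properties using (∷-injective; lookup∘tabulate; tabulate∘lookup; tabulate-cong; lookup-map; ≡-dec)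
open import Function using (_∘_; _⇔_; mk⇔; Equivalence; id; flip)
open import Function.Definitions using (Injective)
open import Relation.Binary.Definitions using (DecidableEquality; tri<; tri≈; tri>)
open import Relation.Binary.PropositionalEquality
open import Relation.Nullary using (¬_; Dec; yes; no; contradiction)
open import Relation.Nullary.Decidable using (⌊_⌋; _×-dec_; ¬?; map′; decidable-stable)
open import Relation.Unary using (Decidable)

open import Algebra.Properties.CommutativeSemigroup ℤ.+-commutativeSemigroup using (interchange)

open Equivalence using (to; from)

-- By primitivity the shifts of w are pairwise ≺-distinct, so w has exactly one pattern π; the
-- cycle τ sending rank π i to rank π (i + 1) is decreasing on the ranks carrying the letter 0
-- and on those carrying the letter 1. A decreasing permutation is an involution, hence for
-- n ≥ 3 the n-cycle τ has exactly one ascent, and the ascent separates the two letters: w can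
-- be recovered from π. Conversely, an n-cycle τ with one ascent and a starting rank give
-- back a word. If this word had a proper period d ∣ n, then for even d the map τ^d would
-- preserve the order along the orbit and hence fix it; for odd d the same applies to 2d,
-- forcing n = 2d ≡ 2 (mod 4). So primitive words, patterns and pairs (start, τ) are
-- equinumerous. Primitive words are counted by exchanging the sum over d ∣ n with the sum over
-- words: a word of least period p contributes the sum of μ over the divisors of n / p.

-- Finite cardinalities

Unique-set⇒↭ : {A : Set} {xs ys : List A} → Unique xs → Unique ys →
               (∀ x → x ∈ xs ⇔ x ∈ ys) → xs ↭ ys
Unique-set⇒↭ u v eq = ∼bag⇒↭ (unique∧set⇒bag u v (λ {x} → eq x))

HasSize-unique : {A : Set} {P : A → Set} {m n : ℕ} → HasSize P m → HasSize P n → m ≡ n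
HasSize-unique (_ , u , p , refl) (_ , v , q , refl) =
  ↭-length (Unique-set⇒↭ u v λ x → mk⇔ (from (q x) ∘ to (p x)) (from (p x) ∘ to (q x)))

HasSize-filter : {A : Set} {P Q : A → Set} {m : ℕ} (Q? : Decidable Q) (s : HasSize P m) →
                 HasSize (λ x → P x × Q x) (length (List.filter Q? (proj₁ s)))
HasSize-filter {Q = Q} Q? (xs , u , p , _) =
  List.filter Q? xs , Unique.filter⁺ Q? u ,
  (λ x → mk⇔ (λ x∈ → let (x∈xs , qx) = ∈-filter⁻ Q? x∈ in to (p x) x∈xs , qx)
             (λ (px , qx) → ∈-filter⁺ Q? (from (p x) px) qx)) ,
  refl

HasSize-⇔ : {A : Set} {P Q : A → Set} {m : ℕ} → (∀ {x} → P x → Q x) → (∀ {x} → Q x → P x) →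
            HasSize P m → HasSize Q m
HasSize-⇔ f g (xs , u , p , l) = xs , u , (λ x → mk⇔ (f ∘ to (p x)) (from (p x) ∘ g)) , l

length-cartesianProductWith : {A B C : Set} (f : A → B → C) (xs : List A) (ys : List B) →
  length (List.cartesianProductWith f xs ys) ≡ length xs * length ys
length-cartesianProductWith f []       ys = refl
length-cartesianProductWith f (x ∷ xs) ys =
  trans (List.length-++ (List.map (f x) ys))
        (cong₂ _+_ (List.length-map (f x) ys) (length-cartesianProductWith f xs ys))

HasSize-× : {A B C : Set} {P : A → Set} {Q : B → Set} {m n : ℕ} (f : A → B → C) →
            (∀ {a a′ b b′} → f a b ≡ f a′ b′ → a ≡ a′ × b ≡ b′) →
            HasSize P m → HasSize Q n →
            HasSize (λ c → ∃ λ a → ∃ λ b → P a × Q b × f a b ≡ c) (m * n)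
HasSize-× f inj (xs , u , p , refl) (ys , v , q , refl) =
  List.cartesianProductWith f xs ys , Unique.cartesianProductWith⁺ f inj u v ,
  (λ c → mk⇔
    (λ c∈ → let (a , b , a∈ , b∈ , e) = ∈-cartesianProductWith⁻ f xs ys c∈
            in a , b , to (p a) a∈ , to (q b) b∈ , sym e)
    (λ { (a , b , pa , qb , refl) → ∈-cartesianProductWith⁺ f (from (p a) pa) (from (q b) qb) })) ,
  length-cartesianProductWith f xs ys

HasSize-Fin : (n : ℕ) → HasSize {Fin n} (λ _ → ⊤) n
HasSize-Fin n = List.allFin n , Unique.allFin⁺ n ,
  (λ i → mk⇔ (λ _ → tt) (λ _ → ∈-allFin i)) , List.length-tabulate (λ i → i)

HasSize-Vec : (k n : ℕ) → HasSize {Vec (Fin k) n} (λ _ → ⊤) (k ^ n)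
HasSize-Vec k zero    = ([] ∷ []) , ([] ∷ []) ,
  (λ { [] → mk⇔ (λ _ → tt) (λ _ → here refl) }) , refl
HasSize-Vec k (suc n) =
  HasSize-⇔ (λ _ → tt) (λ { {x ∷ v} _ → x , v , tt , tt , refl })
    (HasSize-× _∷_ ∷-injective (HasSize-Fin k) (HasSize-Vec k n))

module _ {A B : Set} {P : A → Set} {Q : B → Set} (R : A → B → Set)
         (total      : ∀ {a} → P a → ∃ λ b → R a b)
         (sound      : ∀ {a b} → P a → R a b → Q b)
         (functional : ∀ {a b b′} → P a → R a b → R a b′ → b ≡ b′)
         (onto       : ∀ {b} → Q b → ∃ λ a → P a × R a b) where

  private
    images : (xs : List A) → (∀ {a} → a ∈ xs → P a) → ∃ λ ys → Pointwise R xs ys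
    images []       _ = [] , []
    images (x ∷ xs) p =
      let (y , r)   = total (p (here refl))
          (ys , rs) = images xs (p ∘ there)
      in y ∷ ys , r ∷ rs

    ∈-image⁻ : ∀ {xs ys b} → Pointwise R xs ys → b ∈ ys → ∃ λ a → a ∈ xs × R a b
    ∈-image⁻ (r ∷ rs) (here refl) = _ , here refl , r
    ∈-image⁻ (r ∷ rs) (there b∈)  = let (a , a∈ , q) = ∈-image⁻ rs b∈ in a , there a∈ , q

    ∈-image⁺ : ∀ {xs ys a} → Pointwise R xs ys → a ∈ xs → ∃ λ b → b ∈ ys × R a b
    ∈-image⁺ (r ∷ rs) (here refl) = _ , here refl , r
    ∈-image⁺ (r ∷ rs) (there a∈)  = let (b , b∈ , q) = ∈-image⁺ rs a∈ in b , there b∈ , q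

    ∈-image⇔ : ∀ {xs ys} → Pointwise R xs ys → (∀ x → x ∈ xs ⇔ P x) → ∀ y → y ∈ ys ⇔ Q y
    ∈-image⇔ {xs} {ys} rs p y = mk⇔ fwd bwd
      where
      fwd : y ∈ ys → Q y
      fwd y∈ = let (a , a∈ , r) = ∈-image⁻ rs y∈ in sound (to (p a) a∈) r
      bwd : Q y → y ∈ ys
      bwd qy = let (a , pa , r) = onto qy
                   (b , b∈ , s) = ∈-image⁺ rs (from (p a) pa)
               in subst (_∈ ys) (functional pa s r) b∈

  -- The correspondence is a relation and not a function because the partner of `a` may exist only
  -- under `P a`: a word has a pattern once it is known to be primitive.
  HasSize-bijection : (∀ {a a′ b} → P a → P a′ → R a b → R a′ b → a ≡ a′) →
                      ∀ {m} → HasSize P m → HasSize Q m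
  HasSize-bijection injective (xs , u , p , l) =
    let (ys , rs) = images xs (λ {a} → to (p a))
    in ys , unique rs u (λ {a} → to (p a)) , ∈-image⇔ rs p ,
       trans (sym (Pointwise.Pointwise-length rs)) l
    where
    unique : ∀ {xs ys} → Pointwise R xs ys → Unique xs → (∀ {a} → a ∈ xs → P a) → Unique ys
    unique []       []       _ = []
    unique (r ∷ rs) (x∉ ∷ u) p =
      All.tabulate (λ {b} b∈ y≡b → let (a , a∈ , s) = ∈-image⁻ rs b∈ in
        All.lookup x∉ a∈
          (injective (p (here refl)) (p (there a∈)) (subst (R _) y≡b r) s))
      ∷ unique rs u (p ∘ there)

  -- Without injectivity images may coincide, so the list is deduplicated and its length stays
  -- existential. This is how the cycles are first seen to be finitely many.
  HasSize-image : DecidableEquality B → ∀ {m} → HasSize P m → ∃ λ c → HasSize Q c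
  HasSize-image _≟_ (xs , u , p , l) =
    let (ys , rs) = images xs (λ {a} → to (p a))
    in _ , List.deduplicate _≟_ ys , DecUnique.deduplicate-! _≟_ ys ,
       (λ y → mk⇔ (to (∈-image⇔ rs p y) ∘ ∈-deduplicate⁻ _≟_ ys)
                  (∈-deduplicate⁺ _≟_ ∘ from (∈-image⇔ rs p y))) ,
       refl

-- Finite integer sums

∑ : {A : Set} → List A → (A → ℤ) → ℤ
∑ xs f = List.foldr ℤ._+_ 0ℤ (List.map f xs)

-- The conditional has the shape used in `nL₂`, so that `nL₂ n` is a `∑` of `when` terms by
-- unfolding alone.
when : {P : Set} → Dec P → ℤ → ℤ
when d x = if ⌊ d ⌋ then x else 0ℤ

when-cong : {P Q : Set} (p : Dec P) (q : Dec Q) → (P → Q) → (Q → P) → ∀ x → when p x ≡ when q x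
when-cong (yes _) (yes _) _ _ x = refl
when-cong (no _)  (no _)  _ _ x = refl
when-cong (yes p) (no ¬q) f _ x = contradiction (f p) ¬q
when-cong (no ¬p) (yes q) _ g x = contradiction (g q) ¬p

module _ {A : Set} where

  ∑-cong : {f g : A → ℤ} (xs : List A) → (∀ {x} → x ∈ xs → f x ≡ g x) → ∑ xs f ≡ ∑ xs g
  ∑-cong []       _ = refl
  ∑-cong (x ∷ xs) e = cong₂ ℤ._+_ (e (here refl)) (∑-cong xs (e ∘ there))

  ∑-0 : (xs : List A) → ∑ xs (λ _ → 0ℤ) ≡ 0ℤ
  ∑-0 []       = refl
  ∑-0 (x ∷ xs) = trans (ℤ.+-identityˡ _) (∑-0 xs)

  ∑-+ : (f g : A → ℤ) (xs : List A) → ∑ xs (λ x → f x ℤ.+ g x) ≡ ∑ xs f ℤ.+ ∑ xs g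
  ∑-+ f g []       = refl
  ∑-+ f g (x ∷ xs) = trans (cong (ℤ._+_ (f x ℤ.+ g x)) (∑-+ f g xs)) (interchange (f x) (g x) _ _)

  ∑-neg : (f : A → ℤ) (xs : List A) → ∑ xs (λ x → - f x) ≡ - ∑ xs f
  ∑-neg f []       = refl
  ∑-neg f (x ∷ xs) = trans (cong (ℤ._+_ (- f x)) (∑-neg f xs)) (sym (ℤ.neg-distrib-+ (f x) _))

  ∑-filter : {Q : A → Set} (Q? : Decidable Q) (f : A → ℤ) (xs : List A) →
             ∑ xs (λ x → when (Q? x) (f x)) ≡ ∑ (List.filter Q? xs) f
  ∑-filter Q? f []       = refl
  ∑-filter Q? f (x ∷ xs) with Q? x
  ... | yes _ = cong (ℤ._+_ (f x)) (∑-filter Q? f xs)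
  ... | no  _ = trans (ℤ.+-identityˡ _) (∑-filter Q? f xs)

  ∑-↭ : (f : A → ℤ) {xs ys : List A} → xs ↭ ys → ∑ xs f ≡ ∑ ys f
  ∑-↭ f e = foldr-commMonoid ℤ.+-0-isCommutativeMonoid (↭⇒↭ₛ (↭-map⁺ f e))

  ∑-const : (c : ℤ) (xs : List A) → ∑ xs (λ _ → c) ≡ c ℤ.* + length xs
  ∑-const c []       = sym (ℤ.*-zeroʳ c)
  ∑-const c (x ∷ xs) = trans (cong (ℤ._+_ c) (∑-const c xs)) (sym (ℤ.*-suc c (+ length xs)))

∑-map : {A B : Set} (g : A → B) (f : B → ℤ) (xs : List A) → ∑ (List.map g xs) f ≡ ∑ xs (f ∘ g)
∑-map g f xs = cong (List.foldr ℤ._+_ 0ℤ) (sym (List.map-∘ xs))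

∑-swap : {A B : Set} (f : A → B → ℤ) (xs : List A) (ys : List B) →
         ∑ xs (λ x → ∑ ys (f x)) ≡ ∑ ys (λ y → ∑ xs (λ x → f x y))
∑-swap f []       ys = sym (∑-0 ys)
∑-swap f (x ∷ xs) ys =
  trans (cong (ℤ._+_ (∑ ys (f x))) (∑-swap f xs ys)) (sym (∑-+ (f x) _ ys))

-- The Möbius function

-- Roughness records that all smaller candidates have failed. Once the fuel is spent, `n < 2 + r`,
-- but n divides itself and roughness gives `2 + r ≤ n`; so the default value is never returned.
spfFrom-correct : ∀ fuel n r → 2 ≤ n → (2 + r) Rough n → n < 2 + r + fuel →
  (2 + spfFrom fuel n r) ∣ n × (2 + spfFrom fuel n r) Rough n
spfFrom-correct zero 1 r (s≤s ())
spfFrom-correct zero n@(suc (suc _)) r 2≤n rough n<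
  rewrite +-identityʳ r = contradiction (rough⇒≤ rough) (<⇒≱ n<)
spfFrom-correct (suc fuel) n r 2≤n rough n< with (2 + r) ∣? n
... | yes d = d , rough
... | no ¬d = spfFrom-correct fuel n (suc r) 2≤n (∤⇒rough-suc ¬d rough)
                (subst (n <_) (+-suc (2 + r) fuel) n<)

least-divisor-unique : ∀ {n r s} → (2 + r) ∣ n → (2 + r) Rough n →
                       (2 + s) ∣ n → (2 + s) Rough n → r ≡ s
least-divisor-unique {n} {r} {s} dr Rr ds Rs with <-cmp r s
... | tri< r<s _ _ = contradiction (rough⇒≤ (rough∧∣⇒rough Rs dr)) (<⇒≱ (s≤s (s≤s r<s)))
... | tri≈ _ e _   = e
... | tri> _ _ s<r = contradiction (rough⇒≤ (rough∧∣⇒rough Rr ds)) (<⇒≱ (s≤s (s≤s s<r)))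

spfFrom-unique : ∀ {n r} → 2 ≤ n → (2 + r) ∣ n → (2 + r) Rough n → spfFrom n n 0 ≡ r
spfFrom-unique {n} 2≤n d R =
  let (d′ , R′) = spfFrom-correct n n 0 2≤n 2-rough (s≤s (n≤1+n n))
  in least-divisor-unique d′ R′ d R

-- The offset r becomes an argument here, so that the result of the search can be rewritten to a
-- known least divisor.
μ-step : ℕ → ℕ → ℕ → ℤ
μ-step fuel n r =
  if ⌊ ((2 + r) * (2 + r)) ∣? n ⌋ then 0ℤ else - μ-fuel fuel (n / (2 + r))

μ-fuel-suc : ∀ fuel n → μ-fuel (suc fuel) (2 + n) ≡ μ-step fuel (2 + n) (spfFrom (2 + n) (2 + n) 0)
μ-fuel-suc fuel n = refl

-- Division by `2 + r` lowers the argument by at least one, as fast as the fuel drops, so fuel n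
-- already suffices.
μ-fuel-stable : ∀ f g n → n ≤ f → n ≤ g → μ-fuel f n ≡ μ-fuel g n
μ-fuel-stable zero    zero    n             _ _ = refl
μ-fuel-stable zero    (suc g) zero          _ _ = refl
μ-fuel-stable (suc f) zero    zero          _ _ = refl
μ-fuel-stable (suc f) (suc g) zero          _ _ = refl
μ-fuel-stable (suc f) (suc g) (suc zero)    _ _ = refl
μ-fuel-stable (suc f) (suc g) n@(suc (suc m)) n≤f n≤g = begin
  μ-fuel (suc f) n ≡⟨ μ-fuel-suc f m ⟩
  μ-step f n r     ≡⟨ cong (λ x → if ⌊ ((2 + r) * (2 + r)) ∣? n ⌋ then 0ℤ else - x)
                        (μ-fuel-stable f g (n / (2 + r)) (bound n≤f) (bound n≤g)) ⟩
  μ-step g n r     ≡⟨ μ-fuel-suc g m ⟨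
  μ-fuel (suc g) n ∎
  where
  open ≡-Reasoning
  r = spfFrom n n 0
  bound : ∀ {h} → n ≤ suc h → n / (2 + r) ≤ h
  bound n≤ = ≤-pred (<-≤-trans (m/n<m n (2 + r) (s≤s (s≤s z≤n))) n≤)

module _ {q r : ℕ} (R : (2 + r) Rough q) where

  private p = 2 + r

  -- A divisor of q inherits the roughness of q; hence the search stops at p for every d that p
  -- divides, and stability resets the fuel to `d / p`.
  μ-unfold : ∀ {d} → 2 ≤ d → d ∣ q → p ∣ d →
             μ d ≡ (if ⌊ p * p ∣? d ⌋ then 0ℤ else - μ (d / p))
  μ-unfold {1} (s≤s ())
  μ-unfold {d@(suc (suc e))} 2≤d d∣q p∣d = begin
    μ d                            ≡⟨ μ-fuel-suc (suc e) e ⟩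
    μ-step (suc e) d (spfFrom d d 0) ≡⟨ cong (μ-step (suc e) d)
                                          (spfFrom-unique 2≤d p∣d (rough∧∣⇒rough R d∣q)) ⟩
    μ-step (suc e) d r             ≡⟨ cong (λ x → if ⌊ p * p ∣? d ⌋ then 0ℤ else - x)
                                        (μ-fuel-stable (suc e) (d / p) (d / p)
                                          (≤-pred (m/n<m d p (s≤s (s≤s z≤n)))) ≤-refl) ⟩
    (if ⌊ p * p ∣? d ⌋ then 0ℤ else - μ (d / p)) ∎
    where open ≡-Reasoning

  μ-square : ∀ {d} → 2 ≤ d → d ∣ q → p * p ∣ d → μ d ≡ 0ℤ
  μ-square {d} 2≤d d∣q pp∣d
    with e ← μ-unfold 2≤d d∣q (∣-trans (m∣m*n p) pp∣d) | p * p ∣? d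
  ... | yes _ = e
  ... | no ¬d = contradiction pp∣d ¬d

  μ-*-least : ∀ {a} → 1 ≤ a → p * a ∣ q → ¬ p ∣ a → μ (p * a) ≡ - μ a
  μ-*-least {a} 1≤a pa∣q p∤a
    with e ← μ-unfold (*-mono-≤ {2} {p} {1} (s≤s (s≤s z≤n)) 1≤a) pa∣q (m∣m*n a) | p * p ∣? p * a
  ... | yes d = contradiction (*-cancelˡ-∣ p d) p∤a
  ... | no _  = trans e (cong (-_ ∘ μ) (trans (cong (_/ p) (*-comm p a)) (m*n/n≡m a p)))

-- The range N is kept apart from q because a sum over the range of n later shrinks to the divisors
-- of some q ≤ n.
divisors : ℕ → ℕ → List ℕ
divisors N q = List.filter (_∣? q) (List.map suc (List.upTo N))

divisors-unique : ∀ N q → Unique (divisors N q)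
divisors-unique N q = Unique.filter⁺ (_∣? q) (Unique.map⁺ suc-injective (Unique.upTo⁺ N))

∈-divisors : ∀ {N q} .{{_ : NonZero q}} → q ≤ N → ∀ d → d ∈ divisors N q ⇔ d ∣ q
∈-divisors {N} {q} q≤N d = mk⇔ (λ d∈ → proj₂ (∈-filter⁻ (_∣? q) {xs = List.map suc (List.upTo N)} d∈)) bwd
  where
  bwd : ∀ {d} → d ∣ q → d ∈ divisors N q
  bwd {zero}  z∣q = contradiction (0∣⇒≡0 z∣q) (≢-nonZero⁻¹ q)
  bwd {suc i} d∣q = ∈-filter⁺ (_∣? q)
    (∈-map⁺ suc (∈-upTo⁺ (≤-trans (∣⇒≤ d∣q) q≤N))) d∣q

∑-divisors : ∀ (f : ℕ → ℤ) N q →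
  ∑ (List.upTo N) (λ i → when (suc i ∣? q) (f (suc i))) ≡ ∑ (divisors N q) f
∑-divisors f N q = trans
  (sym (∑-map suc (λ d → when (d ∣? q) (f d)) (List.upTo N)))
  (∑-filter (_∣? q) f (List.map suc (List.upTo N)))

-- With p the least prime of q, every divisor of q divisible by p has p as its own least prime,
-- so a single unfolding of μ gives μ (p * d) = - μ d and the sum cancels in pairs.
∑-μ : ∀ N q .{{_ : NonZero q}} → q ≤ N → ∑ (divisors N q) μ ≡ when (q ≟ 1) 1ℤ
∑-μ N 1 1≤N = ∑-↭ μ {ys = 1 ∷ []} (Unique-set⇒↭ (divisors-unique N 1) ([] ∷ []) λ d → mk⇔
  (λ d∈ → here (∣1⇒≡1 (to (∈-divisors 1≤N d) d∈)))
  (λ { (here refl) → from (∈-divisors 1≤N 1) ∣-refl }))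
∑-μ N q@(suc (suc q′)) q≤N = begin
  ∑ D μ                                  ≡⟨ ∑-cong D split ⟩
  ∑ D (λ d → when (A? d) (μ d) ℤ.+ when (E? d) (μ d)) ≡⟨ ∑-+ _ _ D ⟩
  ∑ D (λ d → when (A? d) (μ d)) ℤ.+ ∑ D (λ d → when (E? d) (μ d))
                                         ≡⟨ cong₂ ℤ._+_ (∑-filter A? μ D) (∑-filter E? μ D) ⟩
  ∑ A μ ℤ.+ ∑ E μ                        ≡⟨ cong (ℤ._+_ (∑ A μ)) (∑-↭ μ E↭pA) ⟩
  ∑ A μ ℤ.+ ∑ (List.map (p *_) A) μ      ≡⟨ cong (ℤ._+_ (∑ A μ)) (∑-map (p *_) μ A) ⟩
  ∑ A μ ℤ.+ ∑ A (λ a → μ (p * a))        ≡⟨ cong (ℤ._+_ (∑ A μ)) (∑-cong A negate) ⟩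
  ∑ A μ ℤ.+ ∑ A (λ a → - μ a)            ≡⟨ cong (ℤ._+_ (∑ A μ)) (∑-neg μ A) ⟩
  ∑ A μ ℤ.- ∑ A μ                        ≡⟨ ℤ.+-inverseʳ (∑ A μ) ⟩
  0ℤ                                     ∎
  where
  open ≡-Reasoning
  r = spfFrom q q 0
  p = 2 + r
  correct = spfFrom-correct q q 0 (s≤s (s≤s z≤n)) 2-rough (s≤s (n≤1+n q))
  rough : p Rough q
  rough = proj₂ correct
  p-prime : Prime p
  p-prime = rough∧∣⇒prime rough (proj₁ correct)
  D = divisors N q
  -- `A?` selects the divisors prime to p, `E?` those that p divides exactly once. On the remaining
  -- ones μ vanishes, and multiplication by p carries A onto E.
  A? = λ d → ¬? (p ∣? d)
  E? = λ d → (p ∣? d) ×-dec ¬? (p * p ∣? d)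
  A = List.filter A? D
  E = List.filter E? D

  ∈D⇒∣ : ∀ {d} → d ∈ D → d ∣ q
  ∈D⇒∣ = to (∈-divisors q≤N _)

  divisor-pos : ∀ {d} → d ∣ q → 1 ≤ d
  divisor-pos {zero}  0∣q = contradiction (0∣⇒≡0 0∣q) λ()
  divisor-pos {suc _} _   = s≤s z≤n

  p∣⇒2≤ : ∀ {d} → d ∣ q → p ∣ d → 2 ≤ d
  p∣⇒2≤ {zero}  d∣q _   = contradiction (divisor-pos d∣q) λ()
  p∣⇒2≤ {suc d} _   p∣d = ≤-trans (s≤s (s≤s z≤n)) (∣⇒≤ p∣d)

  split : ∀ {d} → d ∈ D → μ d ≡ when (A? d) (μ d) ℤ.+ when (E? d) (μ d)
  split {d} d∈ with p ∣? d | p * p ∣? d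
  ... | no _    | _        = sym (ℤ.+-identityʳ (μ d))
  ... | yes _   | no _     = sym (ℤ.+-identityˡ (μ d))
  ... | yes p∣d | yes pp∣d = μ-square rough (p∣⇒2≤ (∈D⇒∣ d∈) p∣d) (∈D⇒∣ d∈) pp∣d

  ∈A⁻ : ∀ {a} → a ∈ A → a ∣ q × ¬ p ∣ a
  ∈A⁻ a∈ = let (a∈D , p∤a) = ∈-filter⁻ A? {xs = D} a∈ in ∈D⇒∣ a∈D , p∤a

  pa∣q : ∀ {a} → a ∣ q → ¬ p ∣ a → p * a ∣ q
  pa∣q {a} (divides k q≡ka) p∤a
    with euclidsLemma k a p-prime (subst (p ∣_) q≡ka (proj₁ correct))
  ... | inj₁ p∣k = subst (p * a ∣_) (sym q≡ka) (*-monoˡ-∣ a p∣k)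
  ... | inj₂ p∣a = contradiction p∣a p∤a

  negate : ∀ {a} → a ∈ A → μ (p * a) ≡ - μ a
  negate a∈ = let (a∣q , p∤a) = ∈A⁻ a∈
              in μ-*-least rough (divisor-pos a∣q) (pa∣q a∣q p∤a) p∤a

  E↭pA : E ↭ List.map (p *_) A
  E↭pA = Unique-set⇒↭ (Unique.filter⁺ E? (divisors-unique N q))
    (Unique.map⁺ (*-cancelˡ-≡ _ _ p) (Unique.filter⁺ A? (divisors-unique N q)))
    (λ d → mk⇔ fwd bwd)
    where
    fwd : ∀ {d} → d ∈ E → d ∈ List.map (p *_) A
    fwd d∈ with ∈-filter⁻ E? {xs = D} d∈
    ... | d∈D , divides a refl , pp∤d = subst (_∈ List.map (p *_) A) (*-comm p a)
      (∈-map⁺ (p *_) (∈-filter⁺ A?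
        (from (∈-divisors q≤N a) (∣-trans (m∣m*n p) (∈D⇒∣ d∈D)))
        λ p∣a → pp∤d (*-monoˡ-∣ p p∣a)))
    bwd : ∀ {d} → d ∈ List.map (p *_) A → d ∈ E
    bwd d∈ with ∈-map⁻ (p *_) d∈
    ... | a , a∈ , refl = let (a∣q , p∤a) = ∈A⁻ a∈ in
      ∈-filter⁺ E? (from (∈-divisors q≤N (p * a)) (pa∣q a∣q p∤a))
        (m∣m*n a , λ pp∣pa → p∤a (*-cancelˡ-∣ p pp∣pa))

-- Periods of infinite words

Per : {A : Set} → (ℕ → A) → ℕ → Set
Per s d = ∀ m → s (d + m) ≡ s m

module _ {A : Set} {s : ℕ → A} where

  Per-* : ∀ k {d} → Per s d → Per s (k * d)
  Per-* zero    _ m = refl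
  Per-* (suc k) {d} p m = trans (cong s (+-assoc d (k * d) m)) (trans (p (k * d + m)) (Per-* k p m))

  Per-cancel : ∀ {a b} → Per s (a + b) → Per s b → Per s a
  Per-cancel {a} {b} pab pb m = begin
    s (a + m)       ≡⟨ pb (a + m) ⟨
    s (b + (a + m)) ≡⟨ cong s (+-assoc b a m) ⟨
    s (b + a + m)   ≡⟨ cong (λ x → s (x + m)) (+-comm b a) ⟩
    s (a + b + m)   ≡⟨ pab m ⟩
    s m             ∎
    where open ≡-Reasoning

  -- Bézout writes the gcd as a difference of multiples of a and b, and periods are closed under
  -- multiples and differences.
  Per-gcd : ∀ {a b} → Per s a → Per s b → Per s (gcd a b)
  Per-gcd {a} {b} pa pb with Bézout.identity (gcd-GCD a b)
  ... | Bézout.+- x y eq = Per-cancel (subst (Per s) (sym eq) (Per-* x pa)) (Per-* y pb)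
  ... | Bézout.-+ x y eq = Per-cancel (subst (Per s) (sym eq) (Per-* y pb)) (Per-* x pa)

  Per-% : ∀ {d} .{{_ : NonZero d}} → Per s d → ∀ m → s (m % d) ≡ s m
  Per-% {d} p m = begin
    s (m % d)               ≡⟨ Per-* (m / d) p (m % d) ⟨
    s (m / d * d + m % d)   ≡⟨ cong s (+-comm (m / d * d) (m % d)) ⟩
    s (m % d + m / d * d)   ≡⟨ cong s (m≡m%n+[m/n]*n m d) ⟨
    s m                     ∎
    where open ≡-Reasoning

  Per-%-≡ : ∀ {d} .{{_ : NonZero d}} → Per s d → ∀ {m l} → m % d ≡ l % d → s m ≡ s l
  Per-%-≡ p {m} {l} e = trans (sym (Per-% p m)) (trans (cong s e) (Per-% p l))

toℕ-mod : ∀ m n .{{_ : NonZero n}} → toℕ (m mod n) ≡ m % n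
toℕ-mod m n = Fin.toℕ-fromℕ< (m%n<n m n)

mod-toℕ : ∀ {n} .{{_ : NonZero n}} (i : Fin n) → toℕ i mod n ≡ i
mod-toℕ {n} i = Fin.toℕ-injective (trans (toℕ-mod (toℕ i) n) (m<n⇒m%n≡m (Fin.toℕ<n i)))

lookup-ext : {A : Set} {n : ℕ} {v w : Vec A n} → (∀ i → lookup v i ≡ lookup w i) → v ≡ w
lookup-ext {v = v} {w} e = trans (sym (tabulate∘lookup v)) (trans (tabulate-cong e) (tabulate∘lookup w))

module _ {k n : ℕ} .{{_ : NonZero n}} where

  periodic-lookup : (w : Vec (Fin k) n) (i : Fin n) → periodic w (toℕ i) ≡ lookup w i
  periodic-lookup w i = cong (lookup w) (mod-toℕ i)

  periodic-Per : (w : Vec (Fin k) n) → Per (periodic w) n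
  periodic-Per w m = cong (lookup w) (Fin.toℕ-injective (begin
    toℕ ((n + m) mod n) ≡⟨ toℕ-mod (n + m) n ⟩
    (n + m) % n         ≡⟨ cong (_% n) (+-comm n m) ⟩
    (m + n) % n         ≡⟨ [m+n]%n≡m%n m n ⟩
    m % n               ≡⟨ toℕ-mod m n ⟨
    toℕ (m mod n)       ∎))
    where open ≡-Reasoning

  periodic-injective : {v w : Vec (Fin k) n} → (∀ m → periodic v m ≡ periodic w m) → v ≡ w
  periodic-injective {v} {w} e = lookup-ext λ i →
    trans (sym (periodic-lookup v i)) (trans (e (toℕ i)) (periodic-lookup w i))

  periodic-tabulate : {s : InfWord k} → Per s n → ∀ m → periodic (tabulate {n = n} (s ∘ toℕ)) m ≡ s m
  periodic-tabulate {s} p m = begin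
    lookup (tabulate (s ∘ toℕ)) (m mod n) ≡⟨ lookup∘tabulate (s ∘ toℕ) (m mod n) ⟩
    s (toℕ (m mod n))                     ≡⟨ cong s (toℕ-mod m n) ⟩
    s (m % n)                             ≡⟨ Per-% p m ⟩
    s m                                   ∎
    where open ≡-Reasoning

  isPowerOfPrefix⇒Per : (w : Vec (Fin k) n) (d : ℕ) .{{_ : NonZero d}} →
                        IsPowerOfPrefix w d → Per (periodic w) d
  isPowerOfPrefix⇒Per w d (d∣n , h) m = begin
    lookup w ((d + m) mod n)    ≡⟨ reduce (d + m) ⟩
    periodic w ((d + m) % d)    ≡⟨ cong (periodic w) (%-remove-+ˡ m (∣-refl {d})) ⟩
    periodic w (m % d)          ≡⟨ reduce m ⟨
    lookup w (m mod n)          ∎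
    where
    open ≡-Reasoning
    reduce : ∀ m → periodic w m ≡ periodic w (m % d)
    reduce m = h (m mod n) (m % d mod n) (begin
      toℕ (m % d mod n)   ≡⟨ toℕ-mod (m % d) n ⟩
      m % d % n           ≡⟨ m<n⇒m%n≡m (<-≤-trans (m%n<n m d) (∣⇒≤ d∣n)) ⟩
      m % d               ≡⟨ m∣n⇒o%n%m≡o%m d n m d∣n ⟨
      m % n % d           ≡⟨ cong (_% d) (toℕ-mod m n) ⟨
      toℕ (m mod n) % d   ∎)

  Per⇒isPowerOfPrefix : (w : Vec (Fin k) n) (d : ℕ) .{{_ : NonZero d}} →
                        d ∣ n → Per (periodic w) d → IsPowerOfPrefix w d
  Per⇒isPowerOfPrefix w d d∣n p = d∣n , λ i j j≡ → begin
    lookup w i              ≡⟨ periodic-lookup w i ⟨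
    periodic w (toℕ i)      ≡⟨ Per-% p (toℕ i) ⟨
    periodic w (toℕ i % d)  ≡⟨ cong (periodic w) j≡ ⟨
    periodic w (toℕ j)      ≡⟨ periodic-lookup w j ⟩
    lookup w j              ∎
    where open ≡-Reasoning

  -- The gcd of d and n is a period that divides n, and primitivity leaves only n itself.
  primitive-Per : (w : Vec (Fin k) n) → Primitive w → ∀ {d} → Per (periodic w) d → n ∣ d
  primitive-Per w prim {d} p with gcd d n in eq | gcd[m,n]∣m d n | gcd[m,n]∣n d n | Per-gcd p (periodic-Per w)
  ... | zero  | _   | 0∣n | _ = contradiction (0∣⇒≡0 0∣n) (≢-nonZero⁻¹ n)
  ... | suc g | g∣d | g∣n | q with suc g ≟ n
  ...   | yes refl = g∣d
  ...   | no g≢n   = contradiction (Per⇒isPowerOfPrefix w (suc g) g∣n q)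
                       (prim g (≤∧≢⇒< (∣⇒≤ g∣n) g≢n))

  -- Both sides of the equation have period n in m, so n comparisons decide it.
  Per? : (w : Vec (Fin k) n) → Decidable (Per (periodic w))
  Per? w d = map′ extend (λ p i → p (toℕ i))
    (Fin.all? λ i → periodic w (d + toℕ i) Fin.≟ periodic w (toℕ i))
    where
    open ≡-Reasoning
    extend : (∀ (i : Fin n) → periodic w (d + toℕ i) ≡ periodic w (toℕ i)) → Per (periodic w) d
    extend h m = begin
      periodic w (d + m)             ≡⟨ Per-%-≡ (periodic-Per w) (begin
          (d + m) % n                     ≡⟨ %-distribˡ-+ d m n ⟩
          (d % n + m % n) % n             ≡⟨ cong (λ x → (d % n + x) % n) (m%n%n≡m%n m n) ⟨
          (d % n + m % n % n) % n         ≡⟨ %-distribˡ-+ d (m % n) n ⟨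
          (d + m % n) % n                 ≡⟨ cong (λ x → (d + x) % n) (toℕ-mod m n) ⟨
          (d + toℕ (m mod n)) % n         ∎) ⟩
      periodic w (d + toℕ (m mod n)) ≡⟨ h (m mod n) ⟩
      periodic w (toℕ (m mod n))     ≡⟨ periodic-lookup w (m mod n) ⟩
      periodic w m                   ∎

-- Such a word repeats its first d letters; two vectors of lengths d and n correspond when they
-- unroll to the same infinite word.
HasSize-Per : ∀ k n d .{{_ : NonZero n}} .{{_ : NonZero d}} → d ∣ n →
              HasSize {Vec (Fin k) n} (λ w → Per (periodic w) d) (k ^ d)
HasSize-Per k n d d∣n@(divides c n≡cd) = HasSize-bijection
  (λ (v : Vec (Fin k) d) (w : Vec (Fin k) n) → ∀ m → periodic v m ≡ periodic w m)
  (λ {v} _ → tabulate (periodic v ∘ toℕ) , λ m →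
     sym (periodic-tabulate (subst (Per (periodic v)) (sym n≡cd) (Per-* c (periodic-Per v))) m))
  (λ {v} _ r m → trans (sym (r (d + m))) (trans (periodic-Per v m) (r m)))
  (λ _ r r′ → periodic-injective (λ m → trans (sym (r m)) (r′ m)))
  (λ {w} p → tabulate (periodic w ∘ toℕ) , tt , periodic-tabulate p)
  (λ _ _ r r′ → periodic-injective (λ m → trans (r m) (sym (r′ m))))
  (HasSize-Vec k d)

-- Least periods and the number of primitive words

least : {P : ℕ → Set} → Decidable P → ∀ n → P n → ∃ λ p → P p × ∀ d → d < p → ¬ P d
least {P} P? = <-rec (λ n → P n → ∃ λ p → P p × ∀ d → d < p → ¬ P d) step
  where
  step : ∀ n → (∀ {m} → m < n → P m → ∃ λ p → P p × ∀ d → d < p → ¬ P d) →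
         P n → ∃ λ p → P p × ∀ d → d < p → ¬ P d
  step n rec pn with anyUpTo? P? n
  ... | yes (m , m<n , pm) = rec m<n pm
  ... | no none            = n , pn , λ d d<n pd → none (d , d<n , pd)

module _ {k n : ℕ} .{{_ : NonZero n}} (w : Vec (Fin k) n) where

  -- The search starts at 1 to exclude the trivial period 0. The gcd of the least period with any
  -- other is again a period, so it cannot be smaller.
  leastPeriod : ∃ λ p → NonZero p × Per (periodic w) p × (∀ {d} → Per (periodic w) d → p ∣ d)
  leastPeriod with least (λ d → (1 ≤? d) ×-dec Per? w d) n (>-nonZero⁻¹ n , periodic-Per w)
  ... | p , (1≤p , per) , minimal = p , p≢0 , per , divides-all
    where
    p≢0 = >-nonZero 1≤p
    instance _ = p≢0
    divides-all : ∀ {d} → Per (periodic w) d → p ∣ d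
    divides-all {d} q with gcd p d | gcd[m,n]∣m p d | gcd[m,n]∣n p d | Per-gcd per q
    ... | zero  | 0∣p | _ | _ = contradiction (0∣⇒≡0 0∣p) (≢-nonZero⁻¹ p)
    ... | suc g | g∣p | g∣d | r with suc g ≟ p
    ...   | yes refl = g∣d
    ...   | no g≢p   = contradiction (s≤s z≤n , r) (minimal (suc g) (≤∧≢⇒< (∣⇒≤ g∣p) g≢p))

  -- Let p be the least period and n = q * p. For d ∣ n, the number n / d is a period iff p ∣ n / d,
  -- that is, iff d ∣ q. What remains is the sum of μ over the divisors of q, which is 1 exactly
  -- when q = 1.
  ∑-μ-periods : ∃ λ (prim? : Dec (Primitive w)) →
    ∑ (List.upTo n) (λ i → when (suc i ∣? n) (when (Per? w (n / suc i)) (μ (suc i))))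
      ≡ when prim? 1ℤ
  ∑-μ-periods with leastPeriod
  ... | p , p≢0 , per , least with least (periodic-Per w)
  ...   | divides q n≡qp = prim? , (begin
    ∑ (List.upTo n) (λ i → when (suc i ∣? n) (when (Per? w (n / suc i)) (μ (suc i))))
      ≡⟨ ∑-cong (List.upTo n) (λ {i} _ → term i) ⟩
    ∑ (List.upTo n) (λ i → when (suc i ∣? q) (μ (suc i)))
      ≡⟨ ∑-divisors μ n q ⟩
    ∑ (divisors n q) μ
      ≡⟨ ∑-μ n q q≤n ⟩
    when (q ≟ 1) 1ℤ
      ≡⟨ when-cong (q ≟ 1) prim? q≡1⇒prim prim⇒q≡1 1ℤ ⟩
    when prim? 1ℤ ∎)
    where
    open ≡-Reasoning
    instance _ = p≢0
    q≢0 : NonZero q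
    q≢0 = ≢-nonZero λ { refl → ≢-nonZero⁻¹ n n≡qp }
    instance _ = q≢0

    q≤n : q ≤ n
    q≤n = subst (q ≤_) (sym n≡qp) (m≤m*n q p)

    term : ∀ i → when (suc i ∣? n) (when (Per? w (n / suc i)) (μ (suc i))) ≡ when (suc i ∣? q) (μ (suc i))
    term i with suc i ∣? n
    ... | no ∤n = when-cong (no ∤n) (suc i ∣? q) (λ ∣n → contradiction ∣n ∤n)
                    (λ ∣q → subst (suc i ∣_) (sym n≡qp) (∣m⇒∣m*n p ∣q)) (μ (suc i))
    ... | yes (divides c n≡) = when-cong (Per? w (n / suc i)) (suc i ∣? q) fwd bwd (μ (suc i))
      where
      n/≡c : n / suc i ≡ c
      n/≡c = trans (cong (_/ suc i) n≡) (m*n/n≡m c (suc i))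
      fwd : Per (periodic w) (n / suc i) → suc i ∣ q
      fwd per′ with least (subst (Per (periodic w)) n/≡c per′)
      ... | divides e refl = divides e (*-cancelʳ-≡ q (e * suc i) p (begin
        q * p            ≡⟨ n≡qp ⟨
        n                ≡⟨ n≡ ⟩
        e * p * suc i    ≡⟨ *-assoc e p (suc i) ⟩
        e * (p * suc i)  ≡⟨ cong (e *_) (*-comm p (suc i)) ⟩
        e * (suc i * p)  ≡⟨ *-assoc e (suc i) p ⟨
        e * suc i * p    ∎))
      bwd : suc i ∣ q → Per (periodic w) (n / suc i)
      bwd (divides e q≡) = subst (Per (periodic w)) (sym (trans n/≡c c≡)) (Per-* e per)
        where
        c≡ : c ≡ e * p
        c≡ = *-cancelʳ-≡ c (e * p) (suc i) (begin
          c * suc i        ≡⟨ n≡ ⟨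
          n                ≡⟨ n≡qp ⟩
          q * p            ≡⟨ cong (_* p) q≡ ⟩
          e * suc i * p    ≡⟨ *-assoc e (suc i) p ⟩
          e * (suc i * p)  ≡⟨ cong (e *_) (*-comm (suc i) p) ⟩
          e * (p * suc i)  ≡⟨ *-assoc e p (suc i) ⟨
          e * p * suc i    ∎)

    q≡1⇒prim : q ≡ 1 → Primitive w
    q≡1⇒prim refl d d<n pow = <⇒≱ d<n (∣⇒≤
      (subst (_∣ suc d) (sym (trans n≡qp (*-identityˡ p))) (least (isPowerOfPrefix⇒Per w (suc d) pow))))

    prim⇒q≡1 : Primitive w → q ≡ 1
    prim⇒q≡1 prim = ∣1⇒≡1 (*-cancelʳ-∣ p (subst₂ _∣_ n≡qp (sym (*-identityˡ p)) (primitive-Per w prim per)))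

    prim? : Dec (Primitive w)
    prim? = map′ q≡1⇒prim prim⇒q≡1 (q ≟ 1)

HasSize-Primitive : (n : ℕ) .{{_ : NonZero n}} →
                    ∃ λ N → HasSize {Vec (Fin 2) n} Primitive N × + N ≡ nL₂ n
HasSize-Primitive n = _ , HasSize-⇔ proj₂ (tt ,_) (HasSize-filter prim? words) , (begin
  + length (List.filter prim? W)            ≡⟨ ℤ.*-identityˡ _ ⟨
  1ℤ ℤ.* + length (List.filter prim? W)     ≡⟨ ∑-const 1ℤ (List.filter prim? W) ⟨
  ∑ (List.filter prim? W) (λ _ → 1ℤ)        ≡⟨ ∑-filter prim? (λ _ → 1ℤ) W ⟨
  ∑ W (λ w → when (prim? w) 1ℤ)             ≡⟨ ∑-cong W (λ {w} _ → proj₂ (∑-μ-periods w)) ⟨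
  ∑ W (λ w → ∑ (List.upTo n) (λ i → term i w))  ≡⟨ ∑-swap (λ w i → term i w) W (List.upTo n) ⟩
  ∑ (List.upTo n) (λ i → ∑ W (term i))      ≡⟨ ∑-cong (List.upTo n) (λ {i} _ → inner i) ⟩
  nL₂ n                                     ∎)
  where
  open ≡-Reasoning
  words = HasSize-Vec 2 n
  W = proj₁ words
  prim? : Decidable (Primitive {2} {n})
  prim? w = proj₁ (∑-μ-periods w)
  term : ℕ → Vec (Fin 2) n → ℤ
  term i w = when (suc i ∣? n) (when (Per? w (n / suc i)) (μ (suc i)))

  count : ∀ i → suc i ∣ n → length (List.filter (λ w → Per? w (n / suc i)) W) ≡ 2 ^ (n / suc i)
  count i i∣n = HasSize-unique
    (HasSize-⇔ proj₂ (tt ,_) (HasSize-filter (λ w → Per? w (n / suc i)) words))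
    (HasSize-Per 2 n (n / suc i) {{_}} {{m/n≢0 i∣n}} (m/n∣m i∣n))
    where
    m/n≢0 : suc i ∣ n → NonZero (n / suc i)
    m/n≢0 i∣n = >-nonZero (m≥n⇒m/n>0 (∣⇒≤ i∣n))

  inner : ∀ i → ∑ W (term i) ≡ when (suc i ∣? n) (μ (suc i) ℤ.* + (2 ^ (n / suc i)))
  inner i with suc i ∣? n
  ... | no _    = ∑-0 W
  ... | yes i∣n = begin
    ∑ W (λ w → when (Per? w (n / suc i)) (μ (suc i)))
      ≡⟨ ∑-filter (λ w → Per? w (n / suc i)) (λ _ → μ (suc i)) W ⟩
    ∑ (List.filter (λ w → Per? w (n / suc i)) W) (λ _ → μ (suc i))
      ≡⟨ ∑-const (μ (suc i)) (List.filter (λ w → Per? w (n / suc i)) W) ⟩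
    μ (suc i) ℤ.* + length (List.filter (λ w → Per? w (n / suc i)) W)
      ≡⟨ cong (λ l → μ (suc i) ℤ.* + l) (count i i∣n) ⟩
    μ (suc i) ℤ.* + (2 ^ (n / suc i)) ∎

-- Self-maps of finite sets

-- A missed value could be punched out of the codomain, giving an injection into a smaller set.
injective⇒surjective : ∀ {n} {f : Fin n → Fin n} → Injective _≡_ _≡_ f → ∀ y → ∃ λ x → f x ≡ y
injective⇒surjective {suc n} {f} inj y with Fin.any? (λ x → f x Fin.≟ y)
... | yes hit = hit
... | no miss = contradiction
  (Fin.injective⇒≤ {f = λ x → punchOut (y≢f x)} (λ {x} {x′} e → inj (Fin.punchOut-injective (y≢f x) (y≢f x′) e)))
  1+n≰n
  where
  y≢f : ∀ x → y ≢ f x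
  y≢f x e = miss (x , sym e)

-- A section g of f is injective, hence onto, so f is its two-sided inverse.
surjective⇒injective : ∀ {n} {f : Fin n → Fin n} → (∀ y → ∃ λ x → f x ≡ y) → Injective _≡_ _≡_ f
surjective⇒injective {n} {f} surj {x} {x′} e = begin
  x         ≡⟨ proj₂ (onto x) ⟨
  g (f′ x)  ≡⟨ cong g (f′≡ x) ⟩
  g (f x)   ≡⟨ cong g e ⟩
  g (f x′)  ≡⟨ cong g (f′≡ x′) ⟨
  g (f′ x′) ≡⟨ proj₂ (onto x′) ⟩
  x′        ∎
  where
  open ≡-Reasoning
  g : Fin n → Fin n
  g y = proj₁ (surj y)
  onto : ∀ x → ∃ λ y → g y ≡ x
  onto = injective⇒surjective λ {y} {y′} e → trans (sym (proj₂ (surj y))) (trans (cong f e) (proj₂ (surj y′)))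
  f′ : Fin n → Fin n
  f′ x = proj₁ (onto x)
  f′≡ : ∀ x → f′ x ≡ f x
  f′≡ x = trans (sym (proj₂ (surj (f′ x)))) (cong f (proj₂ (onto x)))

-- Induction on the value `f i`: some j takes the value one lower under f, and g must rise strictly
-- from j to i.
order-≤ : ∀ {n} {f g : Fin n → Fin n} → (∀ y → ∃ λ x → f x ≡ y) →
          (∀ i j → f i Fin.< f j → g i Fin.< g j) → ∀ i → f i Fin.≤ g i
order-≤ {n} {f} {g} surj mono i = go (toℕ (f i)) i refl
  where
  go : ∀ v i → toℕ (f i) ≡ v → v ≤ toℕ (g i)
  go zero    i _ = z≤n
  go (suc v) i e =
    let v<n     = <-trans (n<1+n v) (subst (_< n) e (Fin.toℕ<n (f i)))
        (j , p) = surj (fromℕ< v<n)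
        fj≡v    = trans (cong toℕ p) (Fin.toℕ-fromℕ< v<n)
    in ≤-<-trans (go v j fj≡v) (mono j i (subst₂ _<_ (sym fj≡v) (sym e) (n<1+n v)))

order-unique : ∀ {n} {f g : Fin n → Fin n} → Injective _≡_ _≡_ f → Injective _≡_ _≡_ g →
               (∀ i j → f i Fin.< f j ⇔ g i Fin.< g j) → ∀ i → f i ≡ g i
order-unique f-inj g-inj e i = Fin.≤-antisym
  (order-≤ (injective⇒surjective f-inj) (λ i j → to (e i j)) i)
  (order-≤ (injective⇒surjective g-inj) (λ i j → from (e i j)) i)

module _ {A : Set} {P Q : A → Set} (P? : Decidable P) (Q? : Decidable Q) (P⊆Q : ∀ {x} → P x → Q x) where

  length-filter-≤ : ∀ xs → length (List.filter P? xs) ≤ length (List.filter Q? xs)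
  length-filter-≤ []       = z≤n
  length-filter-≤ (x ∷ xs) with P? x | Q? x
  ... | yes _ | yes _ = s≤s (length-filter-≤ xs)
  ... | yes p | no ¬q = contradiction (P⊆Q p) ¬q
  ... | no _  | yes _ = m≤n⇒m≤1+n (length-filter-≤ xs)
  ... | no _  | no _  = length-filter-≤ xs

  length-filter-< : ∀ {x xs} → x ∈ xs → ¬ P x → Q x → length (List.filter P? xs) < length (List.filter Q? xs)
  length-filter-< {x} {_ ∷ xs} (here refl) ¬p q with P? x | Q? x
  ... | yes p | _     = contradiction p ¬p
  ... | no _  | yes _ = s≤s (length-filter-≤ xs)
  ... | no _  | no ¬q = contradiction q ¬q
  length-filter-< {xs = y ∷ xs} (there x∈) ¬p q with P? y | Q? y
  ... | yes _ | yes _ = s≤s (length-filter-< x∈ ¬p q)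
  ... | yes p | no ¬q = contradiction (P⊆Q p) ¬q
  ... | no _  | yes _ = m≤n⇒m≤1+n (length-filter-< x∈ ¬p q)
  ... | no _  | no _  = length-filter-< x∈ ¬p q

module _ {n : ℕ} (_≺_ : Fin n → Fin n → Set) (irrefl : ∀ {i} → ¬ i ≺ i)
         (≺-trans : ∀ {i j k} → i ≺ j → j ≺ k → i ≺ k)
         (connex : ∀ {i j} → i ≢ j → i ≺ j ⊎ j ≺ i) where

  -- The rank of i is the number of elements below it, less than n since i is not below itself.
  -- Connexity yields the decision procedure that the counting needs.
  ranking : ∃ λ (π : Vec (Fin n) n) → IsPerm π × (∀ i j → lookup π i Fin.< lookup π j ⇔ i ≺ j)
  ranking = tabulate rankFin , injective , λ i j → mk⇔ (reflects i j) (preserves i j)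
    where
    _≺?_ : ∀ i j → Dec (i ≺ j)
    i ≺? j with i Fin.≟ j
    ... | yes refl = no irrefl
    ... | no i≢j with connex i≢j
    ...   | inj₁ i≺j = yes i≺j
    ...   | inj₂ j≺i = no λ i≺j → irrefl (≺-trans i≺j j≺i)
    rank : Fin n → ℕ
    rank i = length (List.filter (_≺? i) (List.allFin n))
    rank<n : ∀ i → rank i < n
    rank<n i = subst (rank i <_) (List.length-tabulate id)
      (List.filter-notAll (_≺? i) (List.allFin n) (lose (∈-allFin i) irrefl))
    rankFin : Fin n → Fin n
    rankFin i = fromℕ< (rank<n i)
    π = tabulate rankFin
    toℕ-π : ∀ i → toℕ (lookup π i) ≡ rank i
    toℕ-π i = trans (cong toℕ (lookup∘tabulate rankFin i)) (Fin.toℕ-fromℕ< (rank<n i))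
    preserves : ∀ i j → i ≺ j → lookup π i Fin.< lookup π j
    preserves i j i≺j = subst₂ _<_ (sym (toℕ-π i)) (sym (toℕ-π j))
      (length-filter-< (_≺? i) (_≺? j) (λ k≺i → ≺-trans k≺i i≺j) (∈-allFin i) irrefl i≺j)
    reflects : ∀ i j → lookup π i Fin.< lookup π j → i ≺ j
    reflects i j lt with i Fin.≟ j
    ... | yes refl = contradiction lt (<-irrefl refl)
    ... | no i≢j with connex i≢j
    ...   | inj₁ i≺j = i≺j
    ...   | inj₂ j≺i = contradiction (preserves j i j≺i) (<-asym lt)
    injective : IsPerm π
    injective i j e with i Fin.≟ j
    ... | yes i≡j = i≡j
    ... | no i≢j with connex i≢j
    ...   | inj₁ i≺j = contradiction (preserves i j i≺j) (<-irrefl (cong toℕ e))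
    ...   | inj₂ j≺i = contradiction (preserves j i j≺i) (<-irrefl (cong toℕ (sym e)))

-- The alternating order

-- With all signs minus, exactly j minus signs precede index j, so the comparison there depends on
-- the parity of j. Swapping the arguments at each step encodes this without remainders.
Alternating : ℕ → ℕ → ℕ → Set
Alternating zero    a b = a < b
Alternating (suc j) a b = Alternating j b a

Alternating-map : ∀ j {a b c d} → (a < b → c < d) → (b < a → d < c) → Alternating j a b → Alternating j c d
Alternating-map zero    f g = f
Alternating-map (suc j) f g = Alternating-map j g f

Alternating-irrefl : ∀ j {a} → ¬ Alternating j a a
Alternating-irrefl zero    = <-irrefl refl
Alternating-irrefl (suc j) = Alternating-irrefl j

Alternating-trans : ∀ j {a b c} → Alternating j a b → Alternating j b c → Alternating j a c
Alternating-trans zero    p q = <-trans p q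
Alternating-trans (suc j) p q = Alternating-trans j q p

Alternating-connex : ∀ j {a b} → a ≢ b → Alternating j a b ⊎ Alternating j b a
Alternating-connex zero {a} {b} a≢b with <-cmp a b
... | tri< a<b _ _ = inj₁ a<b
... | tri≈ _ a≡b _ = contradiction a≡b a≢b
... | tri> _ _ b<a = inj₂ b<a
Alternating-connex (suc j) a≢b = Alternating-connex j (a≢b ∘ sym)

Alternating-even : ∀ j {a b} → j % 2 ≡ 0 → Alternating j a b → a < b
Alternating-even zero          _ p = p
Alternating-even (suc (suc j)) e p = Alternating-even j e p

Alternating⇒parity : ∀ j {a b} → Alternating j a b → (j % 2 ≡ 0 × a < b) ⊎ (j % 2 ≡ 1 × b < a)
Alternating⇒parity 0             p = inj₁ (refl , p)
Alternating⇒parity 1             p = inj₂ (refl , p)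
Alternating⇒parity (suc (suc j)) p = Alternating⇒parity j p

parity⇒Alternating : ∀ j {a b} → (j % 2 ≡ 0 × a < b) ⊎ (j % 2 ≡ 1 × b < a) → Alternating j a b
parity⇒Alternating 0             (inj₁ (_ , p)) = p
parity⇒Alternating 1             (inj₂ (_ , p)) = p
parity⇒Alternating (suc (suc j)) p              = parity⇒Alternating j p

module _ {k : ℕ} where

  infix 4 _≺_

  _≺_ : InfWord k → InfWord k → Set
  s ≺ t = ∃ λ j → (∀ i → i < j → s i ≡ t i) × Alternating j (toℕ (s j)) (toℕ (t j))

  negCount-allMinus : ∀ (s : InfWord k) j → negCount allMinus s j ≡ j
  negCount-allMinus s zero    = refl
  negCount-allMinus s (suc j) = trans (cong (_+ 1) (negCount-allMinus s j)) (+-comm j 1)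

  Prec⇔≺ : ∀ {s t : InfWord k} → Prec allMinus s t ⇔ s ≺ t
  Prec⇔≺ {s} {t} = mk⇔
    (λ (j , e , p) → j , e , parity⇒Alternating j (subst (Parity j) (negCount-allMinus s j) p))
    (λ (j , e , p) → j , e , subst (Parity j) (sym (negCount-allMinus s j)) (Alternating⇒parity j p))
    where
    Parity : ℕ → ℕ → Set
    Parity j c = (c % 2 ≡ 0 × toℕ (s j) < toℕ (t j)) ⊎ (c % 2 ≡ 1 × toℕ (t j) < toℕ (s j))

  ≺-irrefl : ∀ {s : InfWord k} → ¬ s ≺ s
  ≺-irrefl (j , _ , p) = Alternating-irrefl j p

  ≺-trans : ∀ {s t u : InfWord k} → s ≺ t → t ≺ u → s ≺ u
  ≺-trans {s} {t} {u} (i , s≡t , p) (j , t≡u , q) with <-cmp i j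
  ... | tri< i<j _ _ = i , (λ m m<i → trans (s≡t m m<i) (t≡u m (<-trans m<i i<j))) ,
                       subst (Alternating i (toℕ (s i)) ∘ toℕ) (t≡u i i<j) p
  ... | tri≈ _ refl _ = i , (λ m m<i → trans (s≡t m m<i) (t≡u m m<i)) , Alternating-trans i p q
  ... | tri> _ _ j<i = j , (λ m m<j → trans (s≡t m (<-trans m<j j<i)) (t≡u m m<j)) ,
                       subst (λ x → Alternating j (toℕ x) (toℕ (u j))) (sym (s≡t j j<i)) q

  ≺-connex : ∀ {s t : InfWord k} m → s m ≢ t m → s ≺ t ⊎ t ≺ s
  ≺-connex {s} {t} m s≢t with least (λ i → ¬? (s i Fin.≟ t i)) m s≢t
  ... | j , sj≢tj , agree = Sum.map (λ a → j , (λ i → eq i) , a) (λ a → j , (λ i i<j → sym (eq i i<j)) , a)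
                              (Alternating-connex j (sj≢tj ∘ Fin.toℕ-injective))
    where
    eq : ∀ i → i < j → s i ≡ t i
    eq i i<j = decidable-stable (s i Fin.≟ t i) (agree i i<j)

  ≺-resp : ∀ {s s′ t t′ : InfWord k} → (∀ m → s m ≡ s′ m) → (∀ m → t m ≡ t′ m) → s ≺ t → s′ ≺ t′
  ≺-resp e f (j , eq , p) = j , (λ i i<j → trans (sym (e i)) (trans (eq i i<j) (f i))) ,
    subst₂ (λ a b → Alternating j (toℕ a) (toℕ b)) (e j) (f j) p

  ≺-head : ∀ {s t : InfWord k} → s ≺ t → s 0 Fin.≤ t 0
  ≺-head (zero  , _  , p) = <⇒≤ p
  ≺-head (suc j , eq , _) = ≤-reflexive (cong toℕ (eq 0 (s≤s z≤n)))

  -- Dropping a common first letter lowers the deciding index by one, which flips the parity.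
  ≺-tail : ∀ {s t : InfWord k} → s 0 ≡ t 0 → s ≺ t → shiftBy 1 t ≺ shiftBy 1 s
  ≺-tail e (zero  , _  , p) = contradiction p (<-irrefl (cong toℕ e))
  ≺-tail e (suc j , eq , p) = j , (λ i i<j → sym (eq (suc i) (s≤s i<j))) , p

-- Patterns of primitive words

module _ {k n : ℕ} .{{n≢0 : NonZero n}} (w : Vec (Fin k) n) (prim : Primitive w) where

  private
    s = periodic w

  shifts-agree⇒Per : ∀ i d → (∀ m → s (i + m) ≡ s (i + d + m)) → Per s d
  shifts-agree⇒Per i d e m = begin
    s (d + m)                   ≡⟨ Per-* i (periodic-Per w) (d + m) ⟨
    s (i * n + (d + m))         ≡⟨ cong (λ x → s (x + (d + m))) i*n ⟩
    s (i + c + (d + m))         ≡⟨ cong s (shuffle i c d m) ⟩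
    s (i + d + (c + m))         ≡⟨ e (c + m) ⟨
    s (i + (c + m))             ≡⟨ cong s (+-assoc i c m) ⟨
    s (i + c + m)               ≡⟨ cong (λ x → s (x + m)) i*n ⟨
    s (i * n + m)               ≡⟨ Per-* i (periodic-Per w) m ⟩
    s m                         ∎
    where
    open ≡-Reasoning
    -- Chosen so that `i + c` is a multiple of n: a further shift by c undoes the shift by i.
    c = i * pred n
    i*n : i * n ≡ i + c
    i*n = trans (cong (i *_) (sym (suc-pred n))) (*-suc i (pred n))
    shuffle : ∀ i c d m → i + c + (d + m) ≡ i + d + (c + m)
    shuffle = solve-∀

  -- Agreement on n consecutive positions extends to all of them and makes j - i a period, strictly
  -- between 0 and n, against primitivity.
  shifts-differ : ∀ {i j : Fin n} → i Fin.< j → ∃ λ m → s (toℕ i + m) ≢ s (toℕ j + m)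
  shifts-differ {i} {j} i<j with Fin.all? (λ (m : Fin n) → s (toℕ i + toℕ m) Fin.≟ s (toℕ j + toℕ m))
  ... | no ¬all = let (m , ne) = Fin.¬∀⟶∃¬ n _ (λ (m : Fin n) → s (toℕ i + toℕ m) Fin.≟ s (toℕ j + toℕ m)) ¬all
                  in toℕ m , ne
  ... | yes all = contradiction (∣⇒≤ {{>-nonZero 0<d}} n∣d) (<⇒≱ d<n)
    where
    d = toℕ j ∸ toℕ i
    0<d : 0 < d
    0<d = m<n⇒0<n∸m i<j
    d<n : d < n
    d<n = ≤-<-trans (m∸n≤m (toℕ j) (toℕ i)) (Fin.toℕ<n j)
    shift-Per : ∀ i → Per (shiftBy i s) n
    shift-Per i m = trans (cong s (x∙yz≈y∙xz +-commutativeSemigroup i n m)) (periodic-Per w (i + m))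
    agree : ∀ m → s (toℕ i + m) ≡ s (toℕ j + m)
    agree m = begin
      s (toℕ i + m)               ≡⟨ Per-% (shift-Per (toℕ i)) m ⟨
      s (toℕ i + m % n)           ≡⟨ cong (λ x → s (toℕ i + x)) (toℕ-mod m n) ⟨
      s (toℕ i + toℕ (m mod n))   ≡⟨ all (m mod n) ⟩
      s (toℕ j + toℕ (m mod n))   ≡⟨ cong (λ x → s (toℕ j + x)) (toℕ-mod m n) ⟩
      s (toℕ j + m % n)           ≡⟨ Per-% (shift-Per (toℕ j)) m ⟩
      s (toℕ j + m)               ∎
      where open ≡-Reasoning
    n∣d : n ∣ d
    n∣d = primitive-Per w prim (shifts-agree⇒Per (toℕ i) d λ m →
      trans (agree m) (cong (λ x → s (x + m)) (sym (m+[n∸m]≡n (<⇒≤ i<j)))))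

  shifts-connex : ∀ {i j : Fin n} → i ≢ j →
                  shiftBy (toℕ i) s ≺ shiftBy (toℕ j) s ⊎ shiftBy (toℕ j) s ≺ shiftBy (toℕ i) s
  shifts-connex {i} {j} i≢j with Fin.<-cmp i j
  ... | tri< i<j _ _ = let (m , ne) = shifts-differ i<j in ≺-connex m ne
  ... | tri≈ _ i≡j _ = contradiction i≡j i≢j
  ... | tri> _ _ j<i = let (m , ne) = shifts-differ j<i in ≺-connex m (ne ∘ sym)

  pattern-exists : ∃ λ π → IsPatternOf allMinus w π
  pattern-exists =
    let (π , perm , order) = ranking (λ i j → shiftBy (toℕ i) s ≺ shiftBy (toℕ j) s)
                               ≺-irrefl ≺-trans shifts-connex
    in π , perm , λ i j → mk⇔ (from Prec⇔≺ ∘ to (order i j)) (from (order i j) ∘ to Prec⇔≺)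

pattern-unique : ∀ {k n} .{{_ : NonZero n}} {σ} (w : Vec (Fin k) n) {π ρ} →
                 IsPatternOf σ w π → IsPatternOf σ w ρ → π ≡ ρ
pattern-unique w (π-perm , π-order) (ρ-perm , ρ-order) = lookup-ext
  (order-unique (λ {i} {j} → π-perm i j) (λ {i} {j} → ρ-perm i j)
    λ i j → mk⇔ (from (ρ-order i j) ∘ to (π-order i j)) (from (π-order i j) ∘ to (ρ-order i j)))

-- Ascents

<ᵇ-true : ∀ {x y} → (x <ᵇ y) ≡ true → x < y
<ᵇ-true {x} {y} eq = <ᵇ⇒< x y (subst T (sym eq) tt)

<ᵇ-false : ∀ {x y} → (x <ᵇ y) ≡ false → y ≤ x
<ᵇ-false eq = ≮⇒≥ λ x<y → subst T eq (<⇒<ᵇ x<y)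

-- The sequence v is cut into two nonincreasing runs and ℓ names the run. Weak inequalities are what
-- failing `<ᵇ` tests deliver; for a permutation injectivity makes them strict later.
Lettering : ∀ {n} → (Fin n → ℕ) → (Fin n → Fin 2) → Set
Lettering v ℓ = (∀ i j → i Fin.< j → ℓ i Fin.≤ ℓ j) × (∀ i j → i Fin.< j → ℓ i ≡ ℓ j → v j ≤ v i)

Nonincreasing : ∀ {n} → (Fin n → ℕ) → Set
Nonincreasing v = ∀ i j → i Fin.< j → v j ≤ v i

Nonincreasing⇒ascents≡0 : ∀ {n} (v : Vec ℕ n) → Nonincreasing (lookup v) → ascList (toList v) ≡ 0
Nonincreasing⇒ascents≡0 []          dec = refl
Nonincreasing⇒ascents≡0 (x ∷ [])    dec = refl
Nonincreasing⇒ascents≡0 (x ∷ y ∷ r) dec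
  with x <ᵇ y in eq | Nonincreasing⇒ascents≡0 (y ∷ r) (λ i j i<j → dec (suc i) (suc j) (s≤s i<j))
... | true  | _   = contradiction (<ᵇ-true eq) (≤⇒≯ (dec zero (suc zero) (s≤s z≤n)))
... | false | rec = rec

ascents≡0⇒Nonincreasing : ∀ {n} (v : Vec ℕ n) → ascList (toList v) ≡ 0 → Nonincreasing (lookup v)
ascents≡0⇒Nonincreasing (x ∷ [])    _ zero zero ()
ascents≡0⇒Nonincreasing (x ∷ y ∷ r) e i j i<j with x <ᵇ y in eq
ascents≡0⇒Nonincreasing (x ∷ y ∷ r) () i j i<j | true
ascents≡0⇒Nonincreasing (x ∷ y ∷ r) e (suc i) (suc j) (s≤s i<j) | false =
  ascents≡0⇒Nonincreasing (y ∷ r) e i j i<j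
ascents≡0⇒Nonincreasing (x ∷ y ∷ r) e zero (suc zero) i<j | false = <ᵇ-false eq
ascents≡0⇒Nonincreasing (x ∷ y ∷ r) e zero (suc (suc j)) i<j | false =
  ≤-trans (ascents≡0⇒Nonincreasing (y ∷ r) e zero (suc j) (s≤s z≤n)) (<ᵇ-false eq)

one≤⇒one : ∀ (a : Fin 2) → 1 ≤ toℕ a → a ≡ suc zero
one≤⇒one (suc zero) _ = refl

≤zero⇒zero : ∀ {k} (a : Fin (suc k)) → a Fin.≤ Fin.zero {k} → a ≡ zero
≤zero⇒zero zero _ = refl

-- An ascent cannot lie inside a run, so the letter changes from 0 to 1 there; all later letters are
-- 1 and no further ascent can follow.
Lettering⇒ascents≤1 : ∀ {n} (v : Vec ℕ n) {ℓ} → Lettering (lookup v) ℓ → ascList (toList v) ≤ 1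
Lettering⇒ascents≤1 []       _ = z≤n
Lettering⇒ascents≤1 (x ∷ []) _ = z≤n
Lettering⇒ascents≤1 (x ∷ y ∷ r) {ℓ} (mono , dec)
  with x <ᵇ y in eq | Lettering⇒ascents≤1 (y ∷ r)
                        ((λ i j i<j → mono (suc i) (suc j) (s≤s i<j)) , (λ i j i<j → dec (suc i) (suc j) (s≤s i<j)))
... | false | rec = rec
... | true  | _ with ℓ zero in e₀ | ℓ (suc zero) in e₁ | mono zero (suc zero) (s≤s z≤n)
...   | zero | suc zero | _ = s≤s (≤-reflexive (Nonincreasing⇒ascents≡0 (y ∷ r) λ i j i<j →
          dec (suc i) (suc j) (s≤s i<j) (trans (ones i) (sym (ones j)))))
  where
  ones : ∀ i → ℓ (suc i) ≡ suc zero
  ones zero    = e₁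
  ones (suc i) = one≤⇒one _ (subst (Fin._≤ ℓ (suc (suc i))) e₁ (mono (suc zero) (suc (suc i)) (s≤s (s≤s z≤n))))
...   | zero | zero | _ = contradiction (dec zero (suc zero) (s≤s z≤n) (trans e₀ (sym e₁)))
                            (<⇒≱ (<ᵇ-true eq))
...   | suc zero | suc zero | _ = contradiction (dec zero (suc zero) (s≤s z≤n) (trans e₀ (sym e₁)))
                            (<⇒≱ (<ᵇ-true eq))

-- The cut goes at the ascent: entries up to it get 0, entries after it get 1.
ascents≡1⇒Lettering : ∀ {n} (v : Vec ℕ n) → ascList (toList v) ≡ 1 → ∃ (Lettering (lookup v))
ascents≡1⇒Lettering (x ∷ y ∷ r) e with x <ᵇ y in eq | ascents≡1⇒Lettering (y ∷ r)
... | true  | _   = ℓ , mono , dec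
  where
  ℓ : Fin _ → Fin 2
  ℓ zero    = zero
  ℓ (suc _) = suc zero
  mono : ∀ i j → i Fin.< j → ℓ i Fin.≤ ℓ j
  mono zero    j       _ = z≤n
  mono (suc i) (suc j) _ = s≤s z≤n
  dec : ∀ i j → i Fin.< j → ℓ i ≡ ℓ j → lookup (x ∷ y ∷ r) j ≤ lookup (x ∷ y ∷ r) i
  dec (suc i) (suc j) (s≤s i<j) _ = ascents≡0⇒Nonincreasing (y ∷ r) (suc-injective e) i j i<j
... | false | rec with rec e
...   | ℓ′ , mono′ , dec′ = ℓ , mono , dec
  where
  ℓ : Fin _ → Fin 2
  ℓ zero    = zero
  ℓ (suc i) = ℓ′ i
  mono : ∀ i j → i Fin.< j → ℓ i Fin.≤ ℓ j
  mono zero    j       _         = z≤n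
  mono (suc i) (suc j) (s≤s i<j) = mono′ i j i<j
  y≤x : y ≤ x
  y≤x = <ᵇ-false eq
  dec : ∀ i j → i Fin.< j → ℓ i ≡ ℓ j → lookup (x ∷ y ∷ r) j ≤ lookup (x ∷ y ∷ r) i
  dec (suc i) (suc j)       (s≤s i<j) e = dec′ i j i<j e
  dec zero    (suc zero)    _         _ = y≤x
  -- A later entry has letter 0, so by monotonicity y has it too and the comparison passes through
  -- y.
  dec zero    (suc (suc j)) _         e = ≤-trans (dec′ zero (suc j) (s≤s z≤n) (trans
    (≤zero⇒zero (ℓ′ zero) (subst (ℓ′ zero Fin.≤_) (sym e) (mono′ zero (suc j) (s≤s z≤n)))) e)) y≤x

-- Up to x the first lettering is constantly 0, from x on the second is constantly 1. So v is
-- nonincreasing on both sides of x, and the two sides share x.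
zero≢one⇒Nonincreasing : ∀ {n} {v : Fin n → ℕ} {ℓ ℓ′} → Lettering v ℓ → Lettering v ℓ′ →
                      ∀ x → ℓ x ≡ zero → ℓ′ x ≡ suc zero → Nonincreasing v
zero≢one⇒Nonincreasing {v = v} {ℓ} {ℓ′} (mono , dec) (mono′ , dec′) x ℓx≡0 ℓ′x≡1 = decreasing
  where
  below : ∀ {i} → i Fin.≤ x → ℓ i ≡ zero
  below {i} i≤x with Fin.<-cmp i x
  ... | tri< i<x _ _ = ≤zero⇒zero (ℓ i) (subst (ℓ i Fin.≤_) ℓx≡0 (mono i x i<x))
  ... | tri≈ _ refl _ = ℓx≡0
  ... | tri> _ _ x<i = contradiction i≤x (<⇒≱ x<i)
  above : ∀ {i} → x Fin.≤ i → ℓ′ i ≡ suc zero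
  above {i} x≤i with Fin.<-cmp i x
  ... | tri< i<x _ _ = contradiction x≤i (<⇒≱ i<x)
  ... | tri≈ _ refl _ = ℓ′x≡1
  ... | tri> _ _ x<i = one≤⇒one (ℓ′ i) (subst (Fin._≤ ℓ′ i) ℓ′x≡1 (mono′ x i x<i))
  decreasing : Nonincreasing v
  decreasing i j i<j with toℕ j ≤? toℕ x | toℕ x ≤? toℕ i
  ... | yes j≤x | _ = dec i j i<j (trans (below (<⇒≤ (<-≤-trans i<j j≤x))) (sym (below j≤x)))
  ... | no  _   | yes x≤i = dec′ i j i<j (trans (above x≤i) (sym (above (<⇒≤ (≤-<-trans x≤i i<j)))))
  ... | no j≰x  | no x≰i = ≤-trans
    (dec′ x j (≰⇒> j≰x) (trans ℓ′x≡1 (sym (above (<⇒≤ (≰⇒> j≰x))))))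
    (dec i x (≰⇒> x≰i) (trans (below (<⇒≤ (≰⇒> x≰i))) (sym ℓx≡0)))

Lettering-unique : ∀ {n} {v : Fin n → ℕ} {ℓ ℓ′} → Lettering v ℓ → Lettering v ℓ′ →
                   ¬ Nonincreasing v → ∀ x → ℓ x ≡ ℓ′ x
Lettering-unique {ℓ = ℓ} {ℓ′} L L′ ¬dec x with ℓ x in e | ℓ′ x in e′
... | zero     | zero     = refl
... | suc zero | suc zero = refl
... | zero     | suc zero = contradiction (zero≢one⇒Nonincreasing L L′ x e e′) ¬dec
... | suc zero | zero     = contradiction (zero≢one⇒Nonincreasing L′ L x e′ e) ¬dec

-- Cyclic permutations

module _ {A : Set} (f : A → A) where

  iter-+ : ∀ a b x → iter f (a + b) x ≡ iter f a (iter f b x)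
  iter-+ zero    b x = refl
  iter-+ (suc a) b x = cong f (iter-+ a b x)

  iter-injective : Injective _≡_ _≡_ f → ∀ m → Injective _≡_ _≡_ (iter f m)
  iter-injective inj zero    e = e
  iter-injective inj (suc m) e = iter-injective inj m (inj e)

module _ {n : ℕ} (f : Fin n → Fin n) (inj : Injective _≡_ _≡_ f) (x : Fin n)
         (transitive : ∀ y → ∃ λ m → iter f m x ≡ y) where

  private
    orbit : ℕ → Fin n
    orbit m = iter f m x

  orbit-surjective′ : ∀ q .{{_ : NonZero q}} → Per orbit q → ∀ y → ∃ λ (r : Fin q) → orbit (toℕ r) ≡ y
  orbit-surjective′ q per y =
    let (m , e) = transitive y
    in m mod q , trans (cong orbit (toℕ-mod m q)) (trans (Per-% per m) e)

  -- Two of the first n + 1 orbit points coincide by the pigeonhole principle, and injectivity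
  -- cancels the steps that precede the earlier one.
  return-time : ∃ λ q → 0 < q × q ≤ n × Per orbit q
  return-time with Fin.pigeonhole (n<1+n n) (orbit ∘ toℕ)
  ... | a , b , a<b , e = q , m<n⇒0<n∸m a<b ,
        ≤-trans (m∸n≤m (toℕ b) (toℕ a)) (≤-pred (Fin.toℕ<n b)) , per
    where
    open ≡-Reasoning
    q = toℕ b ∸ toℕ a
    returns : orbit q ≡ x
    returns = iter-injective f inj (toℕ a) (begin
      iter f (toℕ a) (orbit q) ≡⟨ iter-+ f (toℕ a) q x ⟨
      orbit (toℕ a + q)        ≡⟨ cong orbit (m+[n∸m]≡n (<⇒≤ a<b)) ⟩
      orbit (toℕ b)            ≡⟨ e ⟨
      orbit (toℕ a)            ∎)
    per : Per orbit q
    per m = begin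
      orbit (q + m)       ≡⟨ cong orbit (+-comm q m) ⟩
      orbit (m + q)       ≡⟨ iter-+ f m q x ⟩
      iter f m (orbit q)  ≡⟨ cong (iter f m) returns ⟩
      orbit m             ∎

  -- One period of the orbit already visits all n points, so the return time is not below n.
  orbit-Per : Per orbit n
  orbit-Per with return-time
  ... | q , 0<q , q≤n , per = subst (Per orbit) (≤-antisym q≤n n≤q) per
    where
    instance _ = >-nonZero 0<q
    visit = orbit-surjective′ q per
    n≤q : n ≤ q
    n≤q = Fin.injective⇒≤ {f = proj₁ ∘ visit} λ {y} {y′} e →
      trans (sym (proj₂ (visit y))) (trans (cong (orbit ∘ toℕ) e) (proj₂ (visit y′)))

  orbit-injective : .{{_ : NonZero n}} → Injective _≡_ _≡_ (orbit ∘ toℕ {n})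
  orbit-injective = surjective⇒injective (orbit-surjective′ n orbit-Per)

-- If τ were decreasing, its square would preserve the order and be the identity. The orbit of 0
-- would then be 0 and τ 0 only, although 1 and 2 both lie on it.
cyclic⇒¬Nonincreasing : ∀ {n} (τ : Vec (Fin n) n) → 3 ≤ n → IsCyclic τ → ¬ Nonincreasing (toℕ ∘ lookup τ)
cyclic⇒¬Nonincreasing {1} τ (s≤s ())
cyclic⇒¬Nonincreasing {2} τ (s≤s (s≤s ()))
cyclic⇒¬Nonincreasing {suc (suc (suc _))} τ 3≤n (perm , transitive) dec =
  contradiction (trans (hit (suc zero) λ ()) (sym (hit (suc (suc zero)) λ ()))) λ ()
  where
  f = lookup τ
  strict : ∀ i j → i Fin.< j → f j Fin.< f i
  strict i j i<j = ≤∧≢⇒< (dec i j i<j) λ e → <-irrefl (cong toℕ (sym (perm j i (Fin.toℕ-injective e)))) i<j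
  f² : ∀ i j → i Fin.< j ⇔ f (f i) Fin.< f (f j)
  f² i j = mk⇔ (λ i<j → strict (f j) (f i) (strict i j i<j)) reflects
    where
    reflects : f (f i) Fin.< f (f j) → i Fin.< j
    reflects lt with Fin.<-cmp i j
    ... | tri< i<j _ _ = i<j
    ... | tri≈ _ refl _ = contradiction lt (<-irrefl refl)
    ... | tri> _ _ j<i = contradiction lt (<-asym (strict (f i) (f j) (strict j i j<i)))
  involutive : ∀ i → i ≡ f (f i)
  involutive = order-unique id (λ {i} {j} e → perm i j (perm (f i) (f j) e)) f²
  orbit₀ : ∀ m → iter f m zero ≡ zero ⊎ iter f m zero ≡ f zero
  orbit₀ zero = inj₁ refl
  orbit₀ (suc m) with orbit₀ m
  ... | inj₁ e = inj₂ (cong f e)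
  ... | inj₂ e = inj₁ (trans (cong f e) (sym (involutive zero)))
  hit : ∀ y → y ≢ zero → y ≡ f zero
  hit y y≢0 with transitive zero y
  ... | m , refl with orbit₀ m
  ...   | inj₁ e = contradiction e y≢0
  ...   | inj₂ e = e

-- Patterns and the cycles they induce

module _ {n : ℕ} .{{_ : NonZero n}} where

  -- π conjugates the rotation i ↦ i + 1 (mod n) to τ.
  Conjugates : Vec (Fin n) n → Vec (Fin n) n → Set
  Conjugates π τ = ∀ m → lookup τ (periodic π m) ≡ periodic π (suc m)

  module _ (π : Vec (Fin n) n) (perm : IsPerm π) where

    position : ∀ x → ∃ λ i → lookup π i ≡ x
    position = injective⇒surjective (λ {i} {j} → perm i j)

    position-ℕ : ∀ x → ∃ λ (i : Fin n) → periodic π (toℕ i) ≡ x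
    position-ℕ x = let (i , e) = position x in i , trans (periodic-lookup π i) e

    conjugate-exists : ∃ (Conjugates π)
    conjugate-exists = tabulate g , λ m → begin
      lookup (tabulate g) (periodic π m)                 ≡⟨ lookup∘tabulate g (periodic π m) ⟩
      periodic π (suc (toℕ (proj₁ (position (periodic π m)))))
        ≡⟨ cong (periodic π ∘ suc ∘ toℕ) (perm _ _ (proj₂ (position (periodic π m)))) ⟩
      periodic π (suc (toℕ (m mod n)))                   ≡⟨ cong (periodic π ∘ suc) (toℕ-mod m n) ⟩
      periodic π (suc (m % n))                           ≡⟨ Per-% shifted m ⟩
      periodic π (suc m)                                 ∎
      where
      open ≡-Reasoning
      g : Fin n → Fin n
      g x = periodic π (suc (toℕ (proj₁ (position x))))
      shifted : Per (periodic π ∘ suc) n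
      shifted m = trans (cong (periodic π) (sym (+-suc n m))) (periodic-Per π (suc m))

    conjugate-unique : ∀ τ τ′ → Conjugates π τ → Conjugates π τ′ → τ ≡ τ′
    conjugate-unique τ τ′ c c′ = lookup-ext λ x → let (i , e) = position-ℕ x in
      subst (λ y → lookup τ y ≡ lookup τ′ y) e (trans (c (toℕ i)) (sym (c′ (toℕ i))))

  iter-conjugate : ∀ π τ → Conjugates π τ → ∀ m i → iter (lookup τ) m (periodic π i) ≡ periodic π (m + i)
  iter-conjugate π τ c zero    i = refl
  iter-conjugate π τ c (suc m) i = trans (cong (lookup τ) (iter-conjugate π τ c m i)) (c (m + i))

  orbit-conjugate : ∀ π τ → Conjugates π τ → ∀ m → iter (lookup τ) m (periodic π 0) ≡ periodic π m
  orbit-conjugate π τ c m = trans (iter-conjugate π τ c m 0) (cong (periodic π) (+-identityʳ m))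

  conjugate-cyclic : ∀ π τ → IsPerm π → Conjugates π τ → IsCyclic τ
  conjugate-cyclic π τ perm c =
    (λ i j → surjective⇒injective surjective {i} {j}) , transitive
    where
    open ≡-Reasoning
    surjective : ∀ y → ∃ λ x → lookup τ x ≡ y
    -- The position before j is written as n - 1 + j, which is also right for j = 0.
    surjective y = let (j , e) = position-ℕ π perm y in periodic π (pred n + toℕ j) , (begin
      lookup τ (periodic π (pred n + toℕ j))  ≡⟨ c (pred n + toℕ j) ⟩
      periodic π (suc (pred n) + toℕ j)       ≡⟨ cong (λ x → periodic π (x + toℕ j)) (suc-pred n) ⟩
      periodic π (n + toℕ j)                  ≡⟨ periodic-Per π (toℕ j) ⟩
      periodic π (toℕ j)                      ≡⟨ e ⟩
      y                                       ∎)
    transitive : ∀ x y → ∃ λ m → iter (lookup τ) m x ≡ y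
    transitive x y with position-ℕ π perm x | position-ℕ π perm y
    -- From position i, n - i steps lead round to position 0, and j more reach position j.
    ... | i , refl | j , refl = (toℕ j + (n ∸ toℕ i)) , (begin
      iter (lookup τ) (toℕ j + (n ∸ toℕ i)) (periodic π (toℕ i))
        ≡⟨ iter-conjugate π τ c (toℕ j + (n ∸ toℕ i)) (toℕ i) ⟩
      periodic π (toℕ j + (n ∸ toℕ i) + toℕ i)
        ≡⟨ cong (periodic π) (trans (+-assoc (toℕ j) (n ∸ toℕ i) (toℕ i))
             (trans (cong (λ z → toℕ j + z) (m∸n+n≡m (<⇒≤ (Fin.toℕ<n i)))) (+-comm (toℕ j) n))) ⟩
      periodic π (n + toℕ j)
        ≡⟨ periodic-Per π (toℕ j) ⟩
      periodic π (toℕ j) ∎)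

  Lettering-resp : {v v′ : Fin n → ℕ} {ℓ : Fin n → Fin 2} → (∀ i → v i ≡ v′ i) → Lettering v ℓ → Lettering v′ ℓ
  Lettering-resp e (mono , dec) = mono , λ i j i<j eq → subst₂ _≤_ (e j) (e i) (dec i j i<j eq)

  -- Ranks carrying the same letter are reversed by the shift, because a common first letter
  -- flips the alternating order.
  pattern-lettering : ∀ (w : Vec (Fin 2) n) π τ → IsPatternOf allMinus w π → Conjugates π τ →
    ∃ λ ℓ → Lettering (toℕ ∘ lookup τ) ℓ × (∀ i → ℓ (lookup π i) ≡ lookup w i)
  pattern-lettering w π τ (perm , order) c = ℓ , (mono , dec) , ℓ-π
    where
    s = periodic w
    pos : Fin n → Fin n
    pos x = proj₁ (position π perm x)
    π-pos : ∀ x → lookup π (pos x) ≡ x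
    π-pos x = proj₂ (position π perm x)
    ℓ : Fin n → Fin 2
    ℓ x = lookup w (pos x)
    ℓ-π : ∀ i → ℓ (lookup π i) ≡ lookup w i
    ℓ-π i = cong (lookup w) (perm _ _ (π-pos (lookup π i)))
    head≡ : ∀ i → s (toℕ i + 0) ≡ lookup w i
    head≡ i = trans (cong s (+-identityʳ (toℕ i))) (periodic-lookup w i)
    shifts : ∀ x y → x Fin.< y → shiftBy (toℕ (pos x)) s ≺ shiftBy (toℕ (pos y)) s
    shifts x y x<y = to Prec⇔≺ (to (order (pos x) (pos y)) (subst₂ Fin._<_ (sym (π-pos x)) (sym (π-pos y)) x<y))
    mono : ∀ x y → x Fin.< y → ℓ x Fin.≤ ℓ y
    mono x y x<y = subst₂ Fin._≤_ (head≡ (pos x)) (head≡ (pos y)) (≺-head (shifts x y x<y))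
    next : Fin n → Fin n
    next i = suc (toℕ i) mod n
    τ-next : ∀ x → lookup π (next (pos x)) ≡ lookup τ x
    τ-next x = trans (sym (c (toℕ (pos x)))) (cong (lookup τ) (trans (periodic-lookup π (pos x)) (π-pos x)))
    shift-next : ∀ i m → s (toℕ i + (1 + m)) ≡ s (toℕ (next i) + m)
    shift-next i m = begin
      s (toℕ i + (1 + m))         ≡⟨ cong s (+-suc (toℕ i) m) ⟩
      s (suc (toℕ i) + m)         ≡⟨ Per-% {s = λ a → s (a + m)} shifted (suc (toℕ i)) ⟨
      s (suc (toℕ i) % n + m)     ≡⟨ cong (λ a → s (a + m)) (toℕ-mod (suc (toℕ i)) n) ⟨
      s (toℕ (next i) + m)        ∎
      where
      open ≡-Reasoning
      shifted : Per (λ a → s (a + m)) n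
      shifted a = trans (cong s (+-assoc n a m)) (periodic-Per w (a + m))
    dec : ∀ x y → x Fin.< y → ℓ x ≡ ℓ y → lookup τ y Fin.≤ lookup τ x
    dec x y x<y ℓ≡ = <⇒≤ (subst₂ Fin._<_ (τ-next y) (τ-next x)
      (from (order (next (pos y)) (next (pos x))) (from Prec⇔≺
        (≺-resp (shift-next (pos y)) (shift-next (pos x))
          (≺-tail (trans (head≡ (pos x)) (trans ℓ≡ (sym (head≡ (pos y))))) (shifts x y x<y))))))

  module _ (3≤n : 3 ≤ n) where

    -- The lettering read off from the word allows at most one ascent, and a cycle on at least three
    -- points is not nonincreasing.
    pattern⇒C′ : ∀ π τ → InPatterns {2} allMinus n π → Conjugates π τ → InC' n 2 τ
    pattern⇒C′ π τ (w , prim , pat) c = cyclic , ≤-antisym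
      (Lettering⇒ascents≤1 (Vec.map toℕ τ) (Lettering-resp (λ i → sym (lookup-map i toℕ τ))
        (proj₁ (proj₂ (pattern-lettering w π τ pat c)))))
      (n≢0⇒n>0 λ e → cyclic⇒¬Nonincreasing τ 3≤n cyclic λ i j i<j →
        subst₂ _≤_ (lookup-map j toℕ τ) (lookup-map i toℕ τ) (ascents≡0⇒Nonincreasing (Vec.map toℕ τ) e i j i<j))
      where
      cyclic : IsCyclic τ
      cyclic = conjugate-cyclic π τ (proj₁ pat) c

    -- Both words letter the same cycle τ, and a cycle with an ascent has only one lettering.
    word-unique : ∀ (w w′ : Vec (Fin 2) n) π → IsPatternOf allMinus w π → IsPatternOf allMinus w′ π → w ≡ w′
    word-unique w w′ π pat pat′ =
      let (τ , c)           = conjugate-exists π (proj₁ pat)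
          (ℓ , L , ℓ-π)     = pattern-lettering w π τ pat c
          (ℓ′ , L′ , ℓ′-π)  = pattern-lettering w′ π τ pat′ c
          ¬dec              = cyclic⇒¬Nonincreasing τ 3≤n (conjugate-cyclic π τ (proj₁ pat) c)
          ℓ≡ℓ′              = Lettering-unique {v = toℕ ∘ lookup τ} {ℓ} {ℓ′} L L′ ¬dec
      in lookup-ext λ i → trans (sym (ℓ-π i)) (trans (ℓ≡ℓ′ (lookup π i)) (ℓ′-π i))

  -- From lettered cycles back to primitive words

  module _ (π τ : Vec (Fin n) n) (c : Conjugates π τ) (cyclic : IsCyclic τ)
           {ℓ : Fin n → Fin 2} (L : Lettering (toℕ ∘ lookup τ) ℓ) where

    private
      f = lookup τ

      o : ℕ → Fin n
      o = periodic π

      -- The itinerary of the orbit `o`: it records which run of τ each orbit point lies in.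
      s : InfWord 2
      s m = ℓ (o m)

      w : Vec (Fin 2) n
      w = Vec.map ℓ π

      periodic-w : ∀ m → periodic w m ≡ s m
      periodic-w m = lookup-map (m mod n) ℓ π

      o-injective : Injective _≡_ _≡_ (o ∘ toℕ {n})
      o-injective {i} {j} e = orbit-injective f (λ {x} {y} → proj₁ cyclic x y) (o 0) (proj₂ cyclic (o 0))
        (trans (orbit-conjugate π τ c (toℕ i)) (trans e (sym (orbit-conjugate π τ c (toℕ j)))))

      π-perm : IsPerm π
      π-perm i j e = o-injective (trans (periodic-lookup π i) (trans e (sym (periodic-lookup π j))))

      reverses : ∀ {x y} → ℓ x ≡ ℓ y → x Fin.< y → f y Fin.< f x
      reverses {x} {y} ℓ≡ x<y = ≤∧≢⇒< (proj₂ L x y x<y ℓ≡) λ e →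
        <-irrefl (cong toℕ (sym (proj₁ cyclic y x (Fin.toℕ-injective e)))) x<y

      reverses⁻¹ : ∀ {x y} → ℓ x ≡ ℓ y → f y Fin.< f x → x Fin.< y
      reverses⁻¹ {x} {y} ℓ≡ lt with Fin.<-cmp x y
      ... | tri< x<y _ _  = x<y
      ... | tri≈ _ refl _ = contradiction lt (<-irrefl refl)
      ... | tri> _ _ y<x  = contradiction lt (<-asym (reverses (sym ℓ≡) y<x))

      ℓ-reflects-< : ∀ {x y} → ℓ x Fin.< ℓ y → x Fin.< y
      ℓ-reflects-< {x} {y} lt with Fin.<-cmp x y
      ... | tri< x<y _ _  = x<y
      ... | tri≈ _ refl _ = contradiction lt (<-irrefl refl)
      ... | tri> _ _ y<x  = contradiction lt (≤⇒≯ (proj₁ L y x y<x))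

      o-suc : ∀ a j → f (o (a + j)) ≡ o (a + suc j)
      o-suc a j = trans (c (a + j)) (cong o (sym (+-suc a j)))

      -- Each step of τ between points with equal letters reverses their order, so j steps reverse
      -- it j times.
      ahead : ∀ j a b → (∀ i → i < j → s (a + i) ≡ s (b + i)) →
              o a Fin.< o b → Alternating j (toℕ (o (a + j))) (toℕ (o (b + j)))
      ahead zero a b _ lt = subst₂ (λ x y → o x Fin.< o y) (sym (+-identityʳ a)) (sym (+-identityʳ b)) lt
      ahead (suc j) a b agree lt =
        subst₂ (λ x y → Alternating j (toℕ x) (toℕ y)) (o-suc b j) (o-suc a j)
          (Alternating-map j (reverses (agree j (n<1+n j))) (reverses (sym (agree j (n<1+n j))))
            (ahead j a b (λ i i<j → agree i (m<n⇒m<1+n i<j)) lt))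

      behind : ∀ j a b → (∀ i → i < j → s (a + i) ≡ s (b + i)) →
               Alternating j (toℕ (o (a + j))) (toℕ (o (b + j))) → o a Fin.< o b
      behind zero a b _ lt = subst₂ (λ x y → o x Fin.< o y) (+-identityʳ a) (+-identityʳ b) lt
      behind (suc j) a b agree alt = behind j a b (λ i i<j → agree i (m<n⇒m<1+n i<j))
        (Alternating-map j (reverses⁻¹ (agree j (n<1+n j))) (reverses⁻¹ (sym (agree j (n<1+n j))))
          (subst₂ (λ x y → Alternating j (toℕ x) (toℕ y)) (sym (o-suc b j)) (sym (o-suc a j)) alt))

      -- At the deciding index the letters differ, and the smaller letter marks the smaller rank.
      -- Going back through the equal letters transfers this comparison to the starting points.
      ≺⇒< : ∀ a b → shiftBy a s ≺ shiftBy b s → o a Fin.< o b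
      ≺⇒< a b (j , agree , alt) = behind j a b agree (Alternating-map j ℓ-reflects-< ℓ-reflects-< alt)

      -- An even number of steps through equal letters preserves the order, so moving along such
      -- a period would strictly increase (or strictly decrease) forever on the finite orbit.
      no-climb : ∀ e (_⊏_ : Fin n → Fin n → Set) → (∀ {x y z} → x ⊏ y → y ⊏ z → x ⊏ z) →
                 (∀ a → o a ⊏ o (e + a) → o (e + a) ⊏ o (e + (e + a))) →
                 o 0 ⊏ o (e + 0) → o 0 ⊏ o 0
      no-climb e _⊏_ ⊏-trans step start = subst (o 0 ⊏_) returns (far (pred n))
        where
        open ≡-Reasoning
        chain : ∀ k → o (k * e) ⊏ o (suc k * e)
        chain zero    = start
        chain (suc k) = step (k * e) (chain k)
        far : ∀ k → o 0 ⊏ o (suc k * e)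
        far zero    = start
        far (suc k) = ⊏-trans (far k) (chain (suc k))
        returns : o (suc (pred n) * e) ≡ o 0
        returns = begin
          o (suc (pred n) * e) ≡⟨ cong (λ x → o (x * e)) (suc-pred n) ⟩
          o (n * e)            ≡⟨ cong o (trans (*-comm n e) (sym (+-identityʳ (e * n)))) ⟩
          o (e * n + 0)        ≡⟨ Per-* e (periodic-Per π) 0 ⟩
          o 0                  ∎

      -- If the orbit points 0 and e differed, one direction or the other would give an endless
      -- climb. They coincide, and n consecutive orbit points are distinct, so e is a multiple of n.
      even-period : ∀ e → e % 2 ≡ 0 → Per s e → n ∣ e
      even-period e even per = m%n≡0⇒n∣m e n (begin
        e % n            ≡⟨ toℕ-mod e n ⟨
        toℕ (e mod n)    ≡⟨ cong toℕ (π-perm (e mod n) (0 mod n) (trans (cong o (sym (+-identityʳ e))) o-e)) ⟩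
        toℕ (0 mod n)    ≡⟨ toℕ-mod 0 n ⟩
        0 % n            ≡⟨ m*n%n≡0 0 n ⟩
        0                ∎)
        where
        open ≡-Reasoning
        agree : ∀ a i → i < e → s (a + i) ≡ s (e + a + i)
        agree a i _ = sym (trans (cong s (+-assoc e a i)) (per (a + i)))
        up : ∀ a → o a Fin.< o (e + a) → o (e + a) Fin.< o (e + (e + a))
        up a lt = subst₂ (λ x y → o x Fin.< o y) (+-comm a e) (+-comm (e + a) e)
          (Alternating-even e even (ahead e a (e + a) (agree a) lt))
        down : ∀ a → o (e + a) Fin.< o a → o (e + (e + a)) Fin.< o (e + a)
        down a lt = subst₂ (λ x y → o x Fin.< o y) (+-comm (e + a) e) (+-comm a e)
          (Alternating-even e even (ahead e (e + a) a (λ i i<e → sym (agree a i i<e)) lt))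
        o-e : o (e + 0) ≡ o 0
        o-e with Fin.<-cmp (o (e + 0)) (o 0)
        ... | tri< lt _ _ = contradiction (no-climb e (flip Fin._<_) (flip Fin.<-trans) down lt) (<-irrefl refl)
        ... | tri≈ _ eq _ = eq
        ... | tri> _ _ gt = contradiction (no-climb e Fin._<_ Fin.<-trans up gt) (<-irrefl refl)

      w-primitive : ¬ (n % 4 ≡ 2) → Primitive w
      w-primitive n%4≢2 d′ d<n pow@(d∣n , _) = by-parity (m%n<n d 2) refl
        where
        d = suc d′
        per : Per s d
        per m = trans (sym (periodic-w (d + m))) (trans (isPowerOfPrefix⇒Per w d pow m) (periodic-w m))
        by-parity : ∀ {r} → r < 2 → ¬ (d % 2 ≡ r)
        by-parity {0} _ even = <⇒≱ d<n (∣⇒≤ (even-period d even per))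
        -- The even period 2d is a multiple of n; as d properly divides n, this leaves n = 2d with d
        -- odd.
        by-parity {1} _ odd  = n%4≢2 (n≡2d⇒ (n≡2d d∣n))
          where
          n∣2d : n ∣ 2 * d
          n∣2d = even-period (2 * d) (trans (cong (_% 2) (*-comm 2 d)) (m*n%n≡0 d 2)) (Per-* 2 per)
          n≡2d : d ∣ n → n ≡ 2 * d
          n≡2d (divides 0 e)             = contradiction e (≢-nonZero⁻¹ n)
          n≡2d (divides 1 e)             = contradiction (trans (sym (+-identityʳ d)) (sym e)) (<⇒≢ d<n)
          n≡2d (divides (suc (suc q)) e) = ≤-antisym (∣⇒≤ n∣2d)
            (subst (2 * d ≤_) (sym e) (*-monoˡ-≤ d (s≤s (s≤s (z≤n {q})))))
          n≡2d⇒ : n ≡ 2 * d → n % 4 ≡ 2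
          n≡2d⇒ n≡ = begin
            n % 4                         ≡⟨ cong (_% 4) n≡ ⟩
            (2 * d) % 4                   ≡⟨ cong (λ x → (2 * x) % 4) (m≡m%n+[m/n]*n d 2) ⟩
            (2 * (d % 2 + d / 2 * 2)) % 4 ≡⟨ cong (λ r → (2 * (r + d / 2 * 2)) % 4) odd ⟩
            (2 * (1 + d / 2 * 2)) % 4     ≡⟨ cong (_% 4) (double (d / 2)) ⟩
            (2 + d / 2 * 4) % 4           ≡⟨ [m+kn]%n≡m%n 2 (d / 2) 4 ⟩
            2                             ∎
            where
            open ≡-Reasoning
            double : ∀ h → 2 * (1 + h * 2) ≡ 2 + h * 4
            double = solve-∀
        by-parity {suc (suc _)} (s≤s (s≤s ()))

    lettering⇒pattern : ¬ (n % 4 ≡ 2) → InPatterns {2} allMinus n π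
    lettering⇒pattern n%4≢2 = w , prim , π-perm , λ i j → mk⇔ (fwd i j) (bwd i j)
      where
      prim : Primitive w
      prim = w-primitive n%4≢2
      ≺⇒π< : ∀ i j → shiftBy (toℕ i) (periodic w) ≺ shiftBy (toℕ j) (periodic w) → lookup π i Fin.< lookup π j
      ≺⇒π< i j p = subst₂ Fin._<_ (periodic-lookup π i) (periodic-lookup π j)
        (≺⇒< (toℕ i) (toℕ j) (≺-resp (λ m → periodic-w (toℕ i + m)) (λ m → periodic-w (toℕ j + m)) p))
      bwd : ∀ i j → Prec allMinus (shiftBy (toℕ i) (periodic w)) (shiftBy (toℕ j) (periodic w)) →
            lookup π i Fin.< lookup π j
      bwd i j = ≺⇒π< i j ∘ to Prec⇔≺
      fwd : ∀ i j → lookup π i Fin.< lookup π j →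
            Prec allMinus (shiftBy (toℕ i) (periodic w)) (shiftBy (toℕ j) (periodic w))
      -- Primitivity makes the shifts comparable, and the wrong comparison is refuted by the
      -- implication already proved.
      fwd i j lt with shifts-connex w prim {i} {j} (λ { refl → <-irrefl refl lt })
      ... | inj₁ p = from Prec⇔≺ p
      ... | inj₂ p = contradiction (≺⇒π< j i p) (<-asym lt)

  C′⇒pattern : ¬ (n % 4 ≡ 2) → ∀ π τ → InC' n 2 τ → Conjugates π τ → InPatterns {2} allMinus n π
  C′⇒pattern n%4≢2 π τ (cyclic , one) c = lettering⇒pattern π τ c cyclic
    (Lettering-resp (λ i → lookup-map i toℕ τ) (proj₂ (ascents≡1⇒Lettering (Vec.map toℕ τ) one))) n%4≢2

  -- The vector π lists the orbit of x in order, and the orbit closes up after exactly n steps.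
  conjugator-exists : ∀ τ → IsCyclic τ → ∀ x → ∃ λ π → Conjugates π τ × periodic π 0 ≡ x
  conjugator-exists τ (perm , transitive) x = tabulate (orbit ∘ toℕ) ,
    (λ m → trans (cong (lookup τ) (unroll m)) (sym (unroll (suc m)))) , unroll 0
    where
    orbit : ℕ → Fin n
    orbit m = iter (lookup τ) m x
    unroll : ∀ m → periodic (tabulate {n = n} (orbit ∘ toℕ)) m ≡ orbit m
    unroll = periodic-tabulate (orbit-Per (lookup τ) (λ {i} {j} → perm i j) x (transitive x))

theorem3p10 : (n : ℕ) .{{_ : NonZero n}} → 3 ≤ n → ¬ (n % 4 ≡ 2) →
    Σ ℕ λ c → HasSize (InC' n 2) c
    × HasSize (InPatterns {2} allMinus n) (n * c)
    × + (n * c) ≡ nL₂ n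
theorem3p10 n 3≤n n%4≢2 =
  let (N , words , N≡nL₂) = HasSize-Primitive n
      patterns = HasSize-bijection (IsPatternOf {2} allMinus)
        (λ {w} → pattern-exists w)
        (λ {w} prim pat → w , prim , pat)
        (λ {w} _ → pattern-unique w)
        id
        (λ {w} {w′} {π} _ _ → word-unique 3≤n w w′ π)
        words
      -- Only finiteness is gained here: many patterns share a cycle, so c is not yet related to
      -- their number.
      (c , cycles) = HasSize-image (Conjugates {n})
        (λ {π} (_ , _ , perm , _) → conjugate-exists π perm)
        (λ {π} {τ} → pattern⇒C′ 3≤n π τ)
        (λ {π} {τ} {τ′} (_ , _ , perm , _) → conjugate-unique π perm τ τ′)
        -- The start `0 mod n` is an arbitrary choice, since one pattern over τ is enough.
        (λ {τ} C → let (π , conj , _) = conjugator-exists τ (proj₁ C) (0 mod n)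
                   in π , C′⇒pattern n%4≢2 π τ C conj , conj)
        (≡-dec Fin._≟_) patterns
      -- A pattern is determined by its first rank and its cycle, and every such pair occurs. The n
      -- possible first ranks account for the factor n.
      pairs = HasSize-bijection
        (λ ((x , τ) : Fin n × Vec (Fin n) n) π → Conjugates π τ × periodic π 0 ≡ x)
        (λ { {x , τ} (_ , _ , _ , C , refl) → conjugator-exists τ (proj₁ C) x })
        (λ { {x , τ} {π} (_ , _ , _ , C , refl) (conj , _) → C′⇒pattern n%4≢2 π τ C conj })
        (λ { {x , τ} {π} {ρ} _ (conj , e) (conj′ , e′) → periodic-injective λ m →
             trans (sym (orbit-conjugate π τ conj m))
               (trans (cong (iter (lookup τ) m) (trans e (sym e′))) (orbit-conjugate ρ τ conj′ m)) })
        (λ { {π} P@(_ , _ , perm , _) → let (τ , conj) = conjugate-exists π perm in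
             (periodic π 0 , τ) , (_ , _ , tt , pattern⇒C′ 3≤n π τ P conj , refl) , conj , refl })
        (λ { {x , τ} {x′ , τ′} {π} (_ , _ , _ , C , refl) _ (conj , e) (conj′ , e′) →
             let (_ , _ , perm , _) = C′⇒pattern n%4≢2 π τ C conj
             in cong₂ _,_ (trans (sym e) e′) (conjugate-unique π perm τ τ′ conj conj′) })
        (HasSize-× _,_ ,-injective (HasSize-Fin n) cycles)
  -- The patterns have now been counted twice, through pairs and through primitive words.
  in c , cycles , pairs , trans (cong +_ (HasSize-unique pairs patterns)) N≡nL₂
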